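{- Let $r\ge 0$ be an integer and let $a,b$ be indeterminates. For all integers $n\ge 0$, $$\mathcal{G}_{a,b}(n;r)=\sum_{i=0}^n \binom{n}{i}\,\mathcal{G}_{a,b}(n-i;0)\prod_{j=0}^{i-1}\bigl(aj+(a+b)r\bigr)$$ and $$\mathcal{G}_{a,b}(n+1;r)=r\sum_{i=0}^n \binom{n}{i}\, \mathcal{G}_{a,b}(n-i;r-1)\prod_{j=0}^{i}(aj+a+b)+\sum_{i=0}^n \binom{n}{i}\,\mathcal{G}_{a,b}(n-i;r)\prod_{j=0}^{i-1}(aj+a+b).$$
   Context: Write $[m]=\{1,\ldots,m\}$, $[0]=\varnothing$. A Lah distribution of $[m]$ into $\ell$ blocks is a partition of $[m]$ into $\ell$ non-empty, pairwise disjoint blocks in which the elements within each block are linearly ordered (the blocks themselves are not ordered). For integers $n,k,r$ with $0\le k\le n$ and $r\ge 0$, let $\mathcal{L}_r(n,k)$ be the set of Lah distributions of $[n+r]$ into $k+r$ blocks in which the elements of $[r]$ belong to distinct blocks. An element $i$ of a Lah distribution $\lambda$ is a record low if there is no element $j<i$ to the left of $i$ within its block. Let $rec^*(\lambda)$ be the number of record lows of $\lambda$ that are not the smallest element of their block, and let $nrec(\lambda)$ be the number of elements of the underlying set that are not record lows of $\lambda$. The generalized $r$-Lah number is the polynomial in indeterminates $a,b$ $$\mathcal{G}_{a,b}(n,k;r)=\sum_{\lambda\in\mathcal{L}_r(n,k)}a^{nrec(\lambda)}b^{rec^*(\lambda)},$$ with $\mathcal{G}_{a,b}(n,k;r)=0$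 unless $0\le k\le n$ and $r\ge 0$. The row sums are $\mathcal{G}_{a,b}(n;r)=\sum_{k=0}^n\mathcal{G}_{a,b}(n,k;r)$ for $n\ge 0$ (so $\mathcal{G}_{a,b}(n;-1)=0$). Empty sums are $0$ and empty products are $1$. -}

module Defs where

open import Algebra.Bundles using (CommutativeRing; Semiring)
open import Data.Integer.Base using (ℤ; +_; -[1+_])
open import Data.List.Base
  using (List; []; _∷_; _++_; length; map; foldr; filter; concat; concatMap; cartesianProductWith; upTo; inits; zip)
open import Data.List.Membership.Propositional using (_∈_)
open import Data.List.Membership.DecPropositional using () renaming (_∈?_ to ∈-dec)
open import Data.List.Membership.Propositional.Properties
  using (∈-filter⁺; ∈-filter⁻; ∈-cartesianProductWith⁺; ∈-cartesianProductWith⁻; ∈-concat⁺′; ∈-map⁺; ∈-upTo⁺; ∈-++⁺ˡ; ∈-++⁺ʳ; ∈-++⁻; ∈-∃++)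
open import Data.List.Properties using (length-++; ∷-injective; length-map; length-upTo)
open import Data.List.Relation.Binary.Disjoint.Propositional using (Disjoint)
open import Data.List.Relation.Unary.All as All using (All; []; _∷_)
import Data.List.Relation.Unary.All.Properties as All
open import Data.List.Relation.Unary.Any using (Any; any?; here; there)
open import Data.List.Relation.Unary.AllPairs as AllPairs using (AllPairs; []; _∷_; allPairs?)
import Data.List.Relation.Unary.AllPairs.Properties as AllPairs
open import Data.List.Relation.Unary.Unique.Propositional using (Unique)
import Data.List.Relation.Unary.Unique.Propositional.Properties as Unique
open import Data.Nat.Base using (ℕ; zero; suc; _+_; _≤_; _<_; z≤n; s≤s)
open import Data.Nat.ListAction using (sum)
open import Data.Nat.Properties
  using (_≟_; _≤?_; _<?_; ≤-trans; ≤-reflexive; +-suc; m≤m+n; m≤n+m; suc-injective)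
open import Data.Product.Base using (_×_; _,_; proj₁; proj₂)
open import Data.Sum.Base using (inj₁; inj₂)
open import Function.Base using (_∘_)
open import Function.Bundles using (_⇔_; mk⇔)
open import Relation.Binary.PropositionalEquality using (_≡_; _≢_; refl; sym; trans; cong; subst)
open import Relation.Nullary using (¬_; Dec; yes; no; ¬?; contradiction)
open import Relation.Nullary.Decidable using (map′; _×-dec_)

[1⋯_] : ℕ → List ℕ
[1⋯ m ] = map suc (upTo m)

-- A block is listed from left to right in its linear order.
Block : Set
Block = List ℕ

-- For disjoint non-empty blocks this says min B < min C.
_≺_ : Block → Block → Set
B ≺ C = Any (λ i → All (i <_) C) B

-- The unordered family of blocks is represented by its unique listing
-- in increasing order of the smallest elements of the blocks, so that
-- distinct lists are distinct Lah distributions.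
record IsLah (m ℓ : ℕ) (D : List Block) : Set where
  constructor isLah
  field
    ℓ-blocks  : length D ≡ ℓ
    non-empty : All (_≢ []) D
    -- Blocks are pairwise disjoint, and no element is repeated in a block.
    disjoint  : Unique (concat D)
    within    : All (_∈ [1⋯ m ]) (concat D)
    covering  : All (_∈ concat D) [1⋯ m ]
    canonical : AllPairs _≺_ D

-- At most one position of each block carries an element of [1⋯ r ].
Separates : ℕ → List Block → Set
Separates r = All (AllPairs (λ i j → ¬ (i ∈ [1⋯ r ] × j ∈ [1⋯ r ])))

IsRLah : (r n k : ℕ) → List Block → Set
IsRLah r n k D = IsLah (n + r) (k + r) D × Separates r D

_∈?_ : (i : ℕ) (xs : List ℕ) → Dec (i ∈ xs)
_∈?_ = ∈-dec _≟_

[]? : (B : Block) → Dec (B ≡ [])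
[]? []      = yes refl
[]? (_ ∷ _) = no λ ()

isLah? : ∀ m ℓ D → Dec (IsLah m ℓ D)
isLah? m ℓ D = map′
  (λ (p , q , s , t , u , v) → isLah p q s t u v)
  (λ (isLah p q s t u v) → p , q , s , t , u , v)
  (length D ≟ ℓ
    ×-dec All.all? (¬? ∘ []?) D
    ×-dec allPairs? (λ i j → ¬? (i ≟ j)) (concat D)
    ×-dec All.all? (_∈? [1⋯ m ]) (concat D)
    ×-dec All.all? (_∈? concat D) [1⋯ m ]
    ×-dec allPairs? (λ B C → any? (λ i → All.all? (i <?_) C) B) D)

isRLah? : ∀ r n k D → Dec (IsRLah r n k D)
isRLah? r n k D = isLah? (n + r) (k + r) D
  ×-dec All.all? (allPairs? (λ i j → ¬? (i ∈? [1⋯ r ] ×-dec j ∈? [1⋯ r ]))) D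

tuples : {A : Set} → ℕ → List A → List (List A)
tuples zero    xs = [] ∷ []
tuples (suc l) xs = cartesianProductWith _∷_ xs (tuples l xs)

words : ℕ → List Block
words m = concatMap (λ l → tuples l [1⋯ m ]) (upTo (suc m))

-- The set of r-Lah distributions as a list: see ∈-𝓛 and 𝓛-unique below.
𝓛 : (r n k : ℕ) → List (List Block)
𝓛 r n k = filter (isRLah? r n k) (tuples (k + r) (words (n + r)))

-- Each element of a block, paired with the list of elements to its left.
positions : Block → List (List ℕ × ℕ)
positions B = zip (inits B) B

RecordLow : List ℕ × ℕ → Set
RecordLow (left , i) = ¬ Any (_< i) left

recordLow? : ∀ p → Dec (RecordLow p)
recordLow? (left , i) = ¬? (any? (_<? i) left)

Smallest : Block → ℕ → Set
Smallest B i = All (i ≤_) B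

smallest? : ∀ B i → Dec (Smallest B i)
smallest? B i = All.all? (i ≤?_) B

rec* : List Block → ℕ
rec* D = sum (map (λ B → length (filter (λ p → recordLow? p ×-dec ¬? (smallest? B (proj₂ p))) (positions B))) D)

nrec : List Block → ℕ
nrec D = sum (map (λ B → length (filter (λ p → ¬? (recordLow? p)) (positions B))) D)

module RLahNumbers {c ℓ} (R : CommutativeRing c ℓ) where

  open CommutativeRing R public
    using (Carrier; _≈_; 0#; 1#; _*_) renaming (_+_ to _⊕_)

  -- m · x is the m-fold sum x ⊕ ⋯ ⊕ x.
  open import Algebra.Definitions.RawSemiring (Semiring.rawSemiring (CommutativeRing.semiring R)) public
    using (_^_) renaming (_×_ to _·_)

  ∑ : {A : Set} → List A → (A → Carrier) → Carrier
  ∑ xs f = foldr (λ x s → f x ⊕ s) 0# xs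

  ∏ : {A : Set} → List A → (A → Carrier) → Carrier
  ∏ xs f = foldr (λ x p → f x * p) 1# xs

  -- For k > n the list 𝓛 r n k is empty, so 𝒢 vanishes there too.
  𝒢 : (a b : Carrier) (n k : ℕ) (r : ℤ) → Carrier
  𝒢 a b n k (+ r)    = ∑ (𝓛 r n k) (λ D → (a ^ nrec D) * (b ^ rec* D))
  𝒢 a b n k -[1+ _ ] = 0#

  𝒢Σ : (a b : Carrier) (n : ℕ) (r : ℤ) → Carrier
  𝒢Σ a b n r = ∑ (upTo (suc n)) (λ k → 𝒢 a b n k r)

∈-tuples⁺ : ∀ {A : Set} {xs : List A} {ys} → All (_∈ xs) ys → ys ∈ tuples (length ys) xs
∈-tuples⁺ []         = here refl
∈-tuples⁺ (y∈ ∷ ys∈) = ∈-cartesianProductWith⁺ _∷_ y∈ (∈-tuples⁺ ys∈)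

tuples-length : ∀ {A : Set} l {xs : List A} {ys} → ys ∈ tuples l xs → length ys ≡ l
tuples-length zero    (here refl) = refl
tuples-length (suc l) {xs} ys∈ with ∈-cartesianProductWith⁻ _∷_ xs (tuples l xs) ys∈
... | _ , _ , _ , zs∈ , refl = cong suc (tuples-length l zs∈)

tuples-unique : ∀ {A : Set} l {xs : List A} → Unique xs → Unique (tuples l xs)
tuples-unique zero    xs! = [] ∷ []
tuples-unique (suc l) xs! = Unique.cartesianProductWith⁺ _∷_ ∷-injective xs! (tuples-unique l xs!)

[1⋯]-unique : ∀ m → Unique [1⋯ m ]
[1⋯]-unique m = Unique.map⁺ suc-injective (Unique.upTo⁺ m)

words-unique : ∀ m → Unique (words m)
words-unique m = Unique.concat⁺
  (All.map⁺ (All.universal (λ l → tuples-unique l ([1⋯]-unique m)) (upTo (suc m))))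
  (AllPairs.map⁺ (AllPairs.map tuples-disjoint (Unique.upTo⁺ (suc m))))
  where
  tuples-disjoint : ∀ {l l′} → l ≢ l′ → Disjoint (tuples l [1⋯ m ]) (tuples l′ [1⋯ m ])
  tuples-disjoint {l} {l′} l≢l′ (p , q) =
    l≢l′ (trans (sym (tuples-length l p)) (tuples-length l′ q))

unique-length : {xs ys : List ℕ} → Unique xs → All (_∈ ys) xs → length xs ≤ length ys
unique-length []          []         = z≤n
unique-length (x∉ ∷ xs!) (x∈ ∷ xs∈) with ∈-∃++ x∈
... | us , vs , refl = ≤-trans
  (s≤s (unique-length xs! (All.zipWith skip (x∉ , xs∈))))
  (≤-reflexive (trans (cong suc (length-++ us)) (trans (sym (+-suc _ _)) (sym (length-++ us)))))
  where
  skip : ∀ {x y} → x ≢ y × y ∈ us ++ x ∷ vs → y ∈ us ++ vs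
  skip (x≢y , y∈) with ∈-++⁻ us y∈
  ... | inj₁ y∈us         = ∈-++⁺ˡ y∈us
  ... | inj₂ (here refl)  = contradiction refl x≢y
  ... | inj₂ (there y∈vs) = ∈-++⁺ʳ us y∈vs

∈-words : ∀ {m B} → length B ≤ m → All (_∈ [1⋯ m ]) B → B ∈ words m
∈-words {m} B≤m B⊆ = ∈-concat⁺′ (∈-tuples⁺ B⊆) (∈-map⁺ (λ l → tuples l [1⋯ m ]) (∈-upTo⁺ (s≤s B≤m)))

blocks∈words : ∀ m D → length (concat D) ≤ m → All (_∈ [1⋯ m ]) (concat D) → All (_∈ words m) D
blocks∈words m []      _   _  = []
blocks∈words m (B ∷ D) len D⊆ =
  ∈-words (≤-trans (m≤m+n _ _) len′) (All.++⁻ˡ B D⊆)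
  ∷ blocks∈words m D (≤-trans (m≤n+m _ _) len′) (All.++⁻ʳ B D⊆)
  where
  len′ : length B + length (concat D) ≤ m
  len′ = subst (_≤ m) (length-++ B) len

∈-𝓛 : ∀ r n k D → D ∈ 𝓛 r n k ⇔ IsRLah r n k D
∈-𝓛 r n k D = mk⇔
  (λ D∈ → proj₂ (∈-filter⁻ (isRLah? r n k) {xs = universe} D∈))
  (λ lah → ∈-filter⁺ (isRLah? r n k) (∈-universe (proj₁ lah)) lah)
  where
  universe : List (List Block)
  universe = tuples (k + r) (words (n + r))
  ∈-universe : IsLah (n + r) (k + r) D → D ∈ universe
  ∈-universe lah = subst (λ l → D ∈ tuples l (words (n + r))) ℓ-blocks
    (∈-tuples⁺ (blocks∈words (n + r) D
      (≤-trans (unique-length disjoint within)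
               (≤-reflexive (trans (length-map suc (upTo (n + r))) (length-upTo (n + r)))))
      within))
    where open IsLah lah

𝓛-unique : ∀ r n k → Unique (𝓛 r n k)
𝓛-unique r n k = Unique.filter⁺ (isRLah? r n k) (tuples-unique (k + r) (words-unique (n + r)))

{-# OPTIONS --safe #-}
module Submission where

-- Inserting the largest element n + r + 1 into a Lah distribution of [n + r] either opens a new
-- block, or puts it at the front of one of the k + r blocks (a record low that is not minimal,
-- weight b), or right after one of the n + r elements (not a record low, weight a). Hence, with
-- z = r(a + b),
--   𝒢(n+1,k;r) = 𝒢(n,k−1;r) + (an + bk + z) 𝒢(n,k;r).
-- This triangle is solved by polynomials h n k z that also satisfy
--   h(n+1,k;z) = z h(n,k;z+a) + h(n,k−1;z+a+b),
-- so the row sums are ρ(n;z) with ρ(n+1;z) = z ρ(n;z+a) + ρ(n;z+a+b). From this recursion and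
-- Pascal's rule, ρ(n;y+z) is the binomial convolution of ρ(·;y) with the rising products
-- ∏_{j<i} (aj + z). The first identity is y = 0; the second one expands both terms of the
-- recursion for ρ(n+1;z).

open import Defs
open import Algebra.Bundles using (CommutativeRing)
import Data.Nat.Properties as ℕ
open import Algebra.Properties.CommutativeSemigroup ℕ.+-commutativeSemigroup using (x∙yz≈y∙xz)
open import Data.Bool.Base using (Bool; true; false; not; _∧_)
open import Data.Integer.Base using (+_; _-_; 0ℤ; 1ℤ)
open import Data.List.Base using (List; []; _∷_; _++_; _∷ʳ_; map; concat; concatMap; length; filter; zip; inits; upTo; [_])
open import Data.List.Membership.Propositional using (_∈_; _∉_; lose; find)
open import Data.List.Membership.Propositional.Properties
  using (∈-map⁺; ∈-map⁻; ∈-++⁺ˡ; ∈-++⁺ʳ; ∈-++⁻; ∈-upTo⁺; ∈-upTo⁻; ∈-concatMap⁺; ∈-concatMap⁻)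
open import Data.List.Membership.Propositional.Properties.WithK using (unique∧set⇒bag)
open import Data.List.Properties
  using (map-++; map-id; map-upTo; upTo-∷ʳ; concat-++; ++-cancelʳ; ∷-injectiveˡ; ∷-injectiveʳ; filter-all; filter-accept;
         filter-reject; length-++; length-map; length-upTo; zip-map)
open import Data.List.Relation.Binary.BagAndSetEquality using (∼bag⇒↭)
open import Data.List.Relation.Binary.Permutation.Propositional
  using (_↭_; ↭-refl; ↭-sym; ↭-trans; ↭-prep; ↭-swap; ↭⇒↭ₛ; ↭-reflexive)
open import Data.List.Relation.Binary.Permutation.Propositional.Properties
  using (All-resp-↭; Any-resp-↭; ∈-resp-↭; drop-∷; ∷↭∷ʳ; shift; ↭-length)
  renaming (++⁺ˡ to ↭-++⁺ˡ; ++⁺ʳ to ↭-++⁺ʳ)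
import Data.List.Relation.Binary.Permutation.Setoid.Properties as Permutation
open import Data.List.Relation.Unary.All as All using (All; []; _∷_)
import Data.List.Relation.Unary.All.Properties as All
open import Data.List.Relation.Unary.AllPairs as AllPairs using (AllPairs; []; _∷_)
import Data.List.Relation.Unary.AllPairs.Properties as AllPairs
open import Data.List.Relation.Unary.Any as Any using (Any; here; there)
open import Data.List.Relation.Unary.Unique.Propositional using (Unique)
import Data.List.Relation.Unary.Unique.Propositional.Properties as Unique
open import Data.Nat.Base using (ℕ; zero; suc; _+_; _∸_; _≤_; _<_; z≤n; s≤s; s≤s⁻¹)
open import Data.Nat.Combinatorics using (_C_; nCk+nC[k+1]≡[n+1]C[k+1]; k>n⇒nCk≡0)
open import Data.Nat.ListAction using (sum)
open import Data.Nat.ListAction.Properties using (sum-++)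
open import Data.Nat.Properties
  using (_≟_; _≤?_; ≤-refl; ≤-reflexive; ≤-trans; <-irrefl; <-asym; <⇒≤; <⇒≢; <⇒≱; ≰⇒>; n<1+n; m≤n+m; m≤n⇒m≤1+n)
open import Data.Product.Base using (_×_; _,_; proj₁; proj₂; ∃; map₁)
open import Data.Sum.Base using (_⊎_; inj₁; inj₂)
open import Function.Base using (_∘_; id)
open import Function.Bundles using (_⇔_; mk⇔; Equivalence)
open import Relation.Binary.Definitions using (Symmetric)
open import Relation.Binary.PropositionalEquality as ≡
  using (_≡_; _≢_; refl; sym; trans; cong; cong₂; subst; module ≡-Reasoning)
open import Relation.Nullary using (¬_; Dec; yes; no; does; ¬?; contradiction)
open import Relation.Nullary.Decidable using (_×-dec_; does-⇔; dec-true; dec-false)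
open import Relation.Unary using (Decidable)

-- Lists up to permutation, and Lah distributions as permutations of an interval

AllPairs-resp-↭ : ∀ {A : Set} {R : A → A → Set} → Symmetric R →
                  ∀ {xs ys} → xs ↭ ys → AllPairs R xs → AllPairs R ys
AllPairs-resp-↭ {A} {R} R-sym p =
  Permutation.AllPairs-resp-↭ (≡.setoid A) R-sym (subst (R _) , subst (λ x → R x _)) (↭⇒↭ₛ p)

AllPairs-++⁻ˡ : ∀ {A : Set} {R : A → A → Set} xs {ys} → AllPairs R (xs ++ ys) → AllPairs R xs
AllPairs-++⁻ˡ []       _          = []
AllPairs-++⁻ˡ (x ∷ xs) (px ∷ pxs) = All.++⁻ˡ xs px ∷ AllPairs-++⁻ˡ xs pxs

unique-↭ : ∀ {A : Set} {xs ys : List A} → Unique xs → Unique ys → (∀ {x} → x ∈ xs ⇔ x ∈ ys) → xs ↭ ys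
unique-↭ xs! ys! e = ∼bag⇒↭ (unique∧set⇒bag xs! ys! e)

-- The map `f` recovers from each member of `g x` the `x` it came from, so the lists for different
-- `x` have no common member.
unique-concatMap : ∀ {A B : Set} (g : A → List B) (f : B → A) {xs} → Unique xs →
  All (λ x → Unique (g x) × All (λ y → f y ≡ x) (g x)) xs → Unique (concatMap g xs)
unique-concatMap g f []         []                 = []
unique-concatMap g f (x∉ ∷ xs!) ((gx! , fgx) ∷ ps) = Unique.++⁺ gx! (unique-concatMap g f xs! ps)
  λ (y∈gx , y∈) → let (_ , x′∈ , y∈gx′) = find (∈-concatMap⁻ g y∈) in
    All.lookup x∉ x′∈ (trans (sym (All.lookup fgx y∈gx)) (All.lookup (proj₂ (All.lookup ps x′∈)) y∈gx′))

[1⋯]-suc : ∀ m → [1⋯ suc m ] ≡ [1⋯ m ] ∷ʳ suc m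
[1⋯]-suc m = trans (cong (map suc) (sym (upTo-∷ʳ m))) (map-++ suc (upTo m) [ m ])

[1⋯]-suc-↭ : ∀ m → suc m ∷ [1⋯ m ] ↭ [1⋯ suc m ]
[1⋯]-suc-↭ m = ↭-trans (∷↭∷ʳ (suc m) [1⋯ m ]) (↭-reflexive (sym ([1⋯]-suc m)))

∈-[1⋯]⁻ : ∀ {m i} → i ∈ [1⋯ m ] → i ≤ m
∈-[1⋯]⁻ i∈ with _ , j∈ , refl ← ∈-map⁻ suc i∈ = ∈-upTo⁻ j∈

[1⋯]-mono : ∀ {m n i} → m ≤ n → i ∈ [1⋯ m ] → i ∈ [1⋯ n ]
[1⋯]-mono m≤n i∈ with _ , j∈ , refl ← ∈-map⁻ suc i∈ = ∈-map⁺ suc (∈-upTo⁺ (≤-trans (∈-upTo⁻ j∈) m≤n))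

-- With its converse `lah⇐↭`, this trades the three fields `disjoint`, `within` and `covering` for a
-- single permutation, which is easy to carry along insertions and removals.
lah⇒↭ : ∀ {m ℓ D} → IsLah m ℓ D → concat D ↭ [1⋯ m ]
lah⇒↭ {m} lah = unique-↭ disjoint ([1⋯]-unique m) (mk⇔ (All.lookup within) (All.lookup covering))
  where open IsLah lah

lah⇐↭ : ∀ {m ℓ D} → length D ≡ ℓ → All (_≢ []) D → concat D ↭ [1⋯ m ] → AllPairs _≺_ D → IsLah m ℓ D
lah⇐↭ {m} len ne p can = isLah len ne
  (AllPairs-resp-↭ (λ x≢y → x≢y ∘ sym) (↭-sym p) ([1⋯]-unique m))
  (All.tabulate (∈-resp-↭ p)) (All.tabulate (∈-resp-↭ (↭-sym p))) can

-- With m = n + r and ℓ = k + r this is IsRLah r n k; the case m < r carries the induction that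
-- determines 𝓛 r 0 k.
IsPartialLah : (r m ℓ : ℕ) → List Block → Set
IsPartialLah r m ℓ D = IsLah m ℓ D × Separates r D

-- Inserting a new largest element

data Insertion (M : ℕ) : Block → Block → Set where
  here  : ∀ {B} → Insertion M B (M ∷ B)
  there : ∀ {x B B′} → Insertion M B B′ → Insertion M (x ∷ B) (x ∷ B′)

-- The block receiving `M` may be empty here; where this would amount to opening a new block, the
-- lemmas exclude it by assuming the blocks of `D` non-empty.
data BlockInsertion (M : ℕ) : List Block → List Block → Set where
  here  : ∀ {B B′ D} → Insertion M B B′ → BlockInsertion M (B ∷ D) (B′ ∷ D)
  there : ∀ {B D D′} → BlockInsertion M D D′ → BlockInsertion M (B ∷ D) (B ∷ D′)

BoundedBy : ℕ → Block → Set
BoundedBy M B = B ≢ [] × All (_< M) B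

insertion-↭ : ∀ {M B B′} → Insertion M B B′ → M ∷ B ↭ B′
insertion-↭ here      = ↭-refl
insertion-↭ (there i) = ↭-trans (↭-swap _ _ ↭-refl) (↭-prep _ (insertion-↭ i))

insertion-≢[] : ∀ {M B B′} → Insertion M B B′ → B′ ≢ []
insertion-≢[] here ()
insertion-≢[] (there i) ()

blockInsertion-↭ : ∀ {M D D′} → BlockInsertion M D D′ → M ∷ concat D ↭ concat D′
blockInsertion-↭ (here i)          = ↭-++⁺ʳ _ (insertion-↭ i)
blockInsertion-↭ {M} (there {B} j) = ↭-trans (↭-sym (shift M B _)) (↭-++⁺ˡ B (blockInsertion-↭ j))

blockInsertion-length : ∀ {M D D′} → BlockInsertion M D D′ → length D′ ≡ length D
blockInsertion-length (here i)  = refl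
blockInsertion-length (there j) = cong suc (blockInsertion-length j)

blockInsertion-≢[] : ∀ {M D D′} → BlockInsertion M D D′ → All (_≢ []) D → All (_≢ []) D′
blockInsertion-≢[] (here i)  (_ ∷ ps) = insertion-≢[] i ∷ ps
blockInsertion-≢[] (there j) (p ∷ ps) = p ∷ blockInsertion-≢[] j ps

≺-insertˡ⁺ : ∀ {M B B′ E} → Insertion M B B′ → B ≺ E → B′ ≺ E
≺-insertˡ⁺ i B≺C = Any-resp-↭ (insertion-↭ i) (there B≺C)

-- The new element `M` cannot be the witness: `E` has an element, and it lies below `M`.
≺-insertˡ⁻ : ∀ {M B B′ E} → BoundedBy M E → Insertion M B B′ → B′ ≺ E → B ≺ E
≺-insertˡ⁻ C<M i B′≺C with Any-resp-↭ (↭-sym (insertion-↭ i)) B′≺C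
... | there B≺C = B≺C
≺-insertˡ⁻ (C≢[] , [])      i B′≺C | here M<C        = contradiction refl C≢[]
≺-insertˡ⁻ (_ , (x<M ∷ _)) i B′≺C | here (M<x ∷ _) = contradiction x<M (<-asym M<x)

≺-insertʳ⁺ : ∀ {M B E E′} → All (_< M) B → Insertion M E E′ → B ≺ E → B ≺ E′
≺-insertʳ⁺ (i<M ∷ _)   i (here i<C) = here (All-resp-↭ (insertion-↭ i) (i<M ∷ i<C))
≺-insertʳ⁺ (_   ∷ B<M) i (there p)  = there (≺-insertʳ⁺ B<M i p)

≺-insertʳ⁻ : ∀ {M B E E′} → Insertion M E E′ → B ≺ E′ → B ≺ E
≺-insertʳ⁻ i = Any.map (All.tail ∘ All-resp-↭ (↭-sym (insertion-↭ i)))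

-- An element larger than all others changes no block minimum, so the order of the blocks is kept.
canonical⁺ : ∀ {M D D′} → All (BoundedBy M) D → BlockInsertion M D D′ → AllPairs _≺_ D → AllPairs _≺_ D′
canonical⁺ _ (here i) (B≺ ∷ can) = All.map (≺-insertˡ⁺ i) B≺ ∷ can
canonical⁺ ((_ , B<M) ∷ bs) (there j) (B≺ ∷ can) = first j B≺ ∷ canonical⁺ bs j can
  where
  first : ∀ {D D′} → BlockInsertion _ D D′ → All (_ ≺_) D → All (_ ≺_) D′
  first (here i)  (p ∷ ps) = ≺-insertʳ⁺ B<M i p ∷ ps
  first (there j) (p ∷ ps) = p ∷ first j ps

canonical⁻ : ∀ {M D D′} → All (BoundedBy M) D → BlockInsertion M D D′ → AllPairs _≺_ D′ → AllPairs _≺_ D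
canonical⁻ (_ ∷ bs) (here i) (B≺ ∷ can) = All.zipWith (λ (b , p) → ≺-insertˡ⁻ b i p) (bs , B≺) ∷ can
canonical⁻ (_ ∷ bs) (there j) (B≺ ∷ can) = first j B≺ ∷ canonical⁻ bs j can
  where
  first : ∀ {D D′} → BlockInsertion _ D D′ → All (_ ≺_) D′ → All (_ ≺_) D
  first (here i)  (p ∷ ps) = ≺-insertʳ⁻ i p ∷ ps
  first (there j) (p ∷ ps) = p ∷ first j ps

Apart : ℕ → ℕ → ℕ → Set
Apart r i j = ¬ (i ∈ [1⋯ r ] × j ∈ [1⋯ r ])

apart-insert⁻ : ∀ {r M B B′} → Insertion M B B′ → AllPairs (Apart r) B′ → AllPairs (Apart r) (M ∷ B)
apart-insert⁻ i = AllPairs-resp-↭ (λ p (y , x) → p (x , y)) (↭-sym (insertion-↭ i))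

separates⁺ : ∀ {r M D D′} → M ∉ [1⋯ r ] → BlockInsertion M D D′ → Separates r D → Separates r D′
separates⁺ M∉ (here i) (p ∷ ps) =
  AllPairs-resp-↭ (λ p (y , x) → p (x , y)) (insertion-↭ i) (All.universal (λ _ → M∉ ∘ proj₁) _ ∷ p) ∷ ps
separates⁺ M∉ (there j) (p ∷ ps) = p ∷ separates⁺ M∉ j ps

separates⁻ : ∀ {r M D D′} → BlockInsertion M D D′ → Separates r D′ → Separates r D
separates⁻ (here i)  (p ∷ ps) = AllPairs.tail (apart-insert⁻ i p) ∷ ps
separates⁻ (there j) (p ∷ ps) = p ∷ separates⁻ j ps

-- An old element `x` of the block that receives `M` cannot lie in `[1⋯ r ]` together with `M`. If
-- all old elements lie in `[1⋯ r ]`, this rules the insertion out.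
separates-∉ : ∀ {r M D D′} → BlockInsertion M D D′ → All (_≢ []) D → Separates r D′ →
              M ∈ [1⋯ r ] → ∃ λ x → x ∈ concat D × x ∉ [1⋯ r ]
separates-∉ (here {[]} i)    (B≢[] ∷ _) _ _ = contradiction refl B≢[]
separates-∉ (here {x ∷ B} i) _ (p ∷ _) M∈ with apart-insert⁻ i p
... | (M#x ∷ _) ∷ _ = x , here refl , λ x∈ → M#x (M∈ , x∈)
separates-∉ (there {B} j) (_ ∷ ne) (_ ∷ ps) M∈ =
  let (x , x∈ , x∉) = separates-∉ j ne ps M∈ in x , ∈-++⁺ʳ B x∈ , x∉

bounded : ∀ {m D} → All (_≢ []) D → concat D ↭ [1⋯ m ] → All (BoundedBy (suc m)) D
bounded {D = D} ne p = All.zipWith id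
  (ne , All.concat⁻ {xss = D} (All.tabulate (λ x∈ → s≤s (∈-[1⋯]⁻ (∈-resp-↭ p x∈)))))

concat-∷ʳ : ∀ (D : List Block) M → concat (D ++ [ [ M ] ]) ≡ concat D ∷ʳ M
concat-∷ʳ D M = sym (concat-++ D [ [ M ] ])

-- The canonical listing forces the new block into last place, since its only element exceeds all
-- others.
newBlock⁺ : ∀ {r m ℓ D} → IsPartialLah r m ℓ D → IsPartialLah r (suc m) (suc ℓ) (D ++ [ [ suc m ] ])
newBlock⁺ {r} {m} {ℓ} {D} (lah , sep) = lah⇐↭
  (trans (length-++ D) (trans (ℕ.+-comm _ 1) (cong suc ℓ-blocks)))
  (All.++⁺ non-empty ((λ ()) ∷ []))
  (↭-trans (↭-reflexive (concat-∷ʳ D (suc m)))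
    (↭-trans (↭-sym (∷↭∷ʳ (suc m) _)) (↭-trans (↭-prep _ (lah⇒↭ lah)) ([1⋯]-suc-↭ m))))
  (AllPairs.++⁺ canonical ([] ∷ []) (All.map ≺M (bounded non-empty (lah⇒↭ lah))))
  , All.++⁺ sep (([] ∷ []) ∷ [])
  where
  open IsLah lah
  ≺M : ∀ {B} → BoundedBy (suc m) B → All (B ≺_) [ [ suc m ] ]
  ≺M (B≢[] , [])     = contradiction refl B≢[]
  ≺M (_ , (x<M ∷ _)) = here (x<M ∷ []) ∷ []

newBlock⁻ : ∀ {r m ℓ} D → IsPartialLah r (suc m) ℓ (D ++ [ [ suc m ] ]) →
            ∃ λ ℓ′ → suc ℓ′ ≡ ℓ × IsPartialLah r m ℓ′ D
newBlock⁻ {m = m} D (lah , sep) = length D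
  , trans (ℕ.+-comm 1 _) (trans (sym (length-++ D)) ℓ-blocks)
  , lah⇐↭ refl (All.++⁻ˡ D non-empty)
      (drop-∷ (↭-trans (∷↭∷ʳ (suc m) _) (↭-trans (↭-reflexive (sym (concat-∷ʳ D (suc m))))
        (↭-trans (lah⇒↭ lah) (↭-sym ([1⋯]-suc-↭ m))))))
      (AllPairs-++⁻ˡ D canonical)
  , All.++⁻ˡ D sep
  where open IsLah lah

-- By `r ≤ m` the new element lies outside `[1⋯ r ]`, so it may join any block without breaking the
-- separation.
insert⁺ : ∀ {r m ℓ D D′} → r ≤ m → IsPartialLah r m ℓ D → BlockInsertion (suc m) D D′ →
          IsPartialLah r (suc m) ℓ D′
insert⁺ {m = m} r≤m (lah , sep) j = lah⇐↭
  (trans (blockInsertion-length j) ℓ-blocks)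
  (blockInsertion-≢[] j non-empty)
  (↭-trans (↭-sym (blockInsertion-↭ j)) (↭-trans (↭-prep _ (lah⇒↭ lah)) ([1⋯]-suc-↭ m)))
  (canonical⁺ (bounded non-empty (lah⇒↭ lah)) j canonical)
  , separates⁺ (λ M∈ → <⇒≱ (∈-[1⋯]⁻ M∈) r≤m) j sep
  where open IsLah lah

insert⁻ : ∀ {r m ℓ D D′} → IsPartialLah r (suc m) ℓ D′ → BlockInsertion (suc m) D D′ → All (_≢ []) D →
          r ≤ m × IsPartialLah r m ℓ D
insert⁻ {r} {m} {ℓ} {D} (lah , sep) j ne = r≤m
  , lah⇐↭ (trans (sym (blockInsertion-length j)) ℓ-blocks) ne D↭ (canonical⁻ (bounded ne D↭) j canonical)
  , separates⁻ j sep
  where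
  open IsLah lah
  D↭ : concat D ↭ [1⋯ m ]
  D↭ = drop-∷ (↭-trans (blockInsertion-↭ j) (↭-trans (lah⇒↭ lah) (↭-sym ([1⋯]-suc-↭ m))))
  r≤m : r ≤ m
  r≤m with r ≤? m
  ... | yes r≤m = r≤m
  -- If `m < r`, then `suc m` and every older element lie in `[1⋯ r ]`, so the block joined by
  -- `suc m` would hold two elements of `[1⋯ r ]`.
  ... | no  r≰m =
    let (x , x∈ , x∉) = separates-∉ j ne sep (∈-map⁺ suc (∈-upTo⁺ (≰⇒> r≰m)))
    in contradiction ([1⋯]-mono (<⇒≤ (≰⇒> r≰m)) (∈-resp-↭ D↭ x∈)) x∉

∈-insertion : ∀ {M B} → M ∈ B → ∃ λ E → Insertion M E B
∈-insertion (here refl) = _ , here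
∈-insertion (there M∈)  = let (E , i) = ∈-insertion M∈ in _ , there i

-- The cases are whether deleting `M` empties its block. If it does, the block is `[ M ]`, and a
-- later block would, by the canonical order, consist of elements above the maximum `M`; hence
-- `[ M ]` is last.
extract : ∀ {M} D′ → M ∈ concat D′ → All (_≢ []) D′ → All (_≤ M) (concat D′) → AllPairs _≺_ D′ →
  (∃ λ D → D′ ≡ D ++ [ [ M ] ]) ⊎ (∃ λ D → BlockInsertion M D D′ × All (_≢ []) D)
extract (B ∷ D′) M∈ (B≢[] ∷ ne) ≤M (B≺ ∷ can) with ∈-++⁻ B M∈
extract (B ∷ D′) M∈ (B≢[] ∷ ne) ≤M (B≺ ∷ can) | inj₂ M∈D′ with extract D′ M∈D′ ne (All.++⁻ʳ B ≤M) can
... | inj₁ (D , eq)     = inj₁ (B ∷ D , cong (B ∷_) eq)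
... | inj₂ (D , j , ps) = inj₂ (B ∷ D , there j , B≢[] ∷ ps)
extract (B ∷ D′) M∈ (B≢[] ∷ ne) ≤M (B≺ ∷ can) | inj₁ M∈B with ∈-insertion M∈B
extract (B ∷ D′) M∈ (B≢[] ∷ ne) ≤M (B≺ ∷ can) | inj₁ M∈B | x ∷ E , i = inj₂ (_ , here i , (λ ()) ∷ ne)
extract (_ ∷ []) M∈ (B≢[] ∷ ne) ≤M (B≺ ∷ can) | inj₁ M∈B | [] , here = inj₁ ([] , refl)
extract (_ ∷ [] ∷ D′) M∈ (B≢[] ∷ C≢[] ∷ ne) ≤M (B≺ ∷ can) | inj₁ M∈B | [] , here = contradiction refl C≢[]
extract (_ ∷ (x ∷ E) ∷ D′) M∈ (B≢[] ∷ ne) (_ ∷ x≤M ∷ _) ((here (M<x ∷ _) ∷ _) ∷ can) | inj₁ M∈B | [] , here =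
  contradiction x≤M (<⇒≱ M<x)

removeLargest : ∀ {r m ℓ D′} → IsPartialLah r (suc m) ℓ D′ →
  (∃ λ D → D′ ≡ D ++ [ [ suc m ] ] × ∃ λ ℓ′ → suc ℓ′ ≡ ℓ × IsPartialLah r m ℓ′ D)
  ⊎ (∃ λ D → BlockInsertion (suc m) D D′ × r ≤ m × IsPartialLah r m ℓ D)
removeLargest {m = m} {D′ = D′} lah@(isLah _ ne _ within _ can , _) with
  extract D′ (∈-resp-↭ (↭-trans ([1⋯]-suc-↭ m) (↭-sym (lah⇒↭ (proj₁ lah)))) (here refl)) ne (All.map ∈-[1⋯]⁻ within) can
... | inj₁ (D , refl)   = inj₁ (D , refl , newBlock⁻ D lah)
... | inj₂ (D , j , ps) = inj₂ (D , j , insert⁻ lah j ps)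

-- The base case, and lower bound on the number of blocks

singletons : ℕ → List Block
singletons zero    = []
singletons (suc m) = singletons m ++ [ [ suc m ] ]

singletons-lah : ∀ r m → IsPartialLah r m m (singletons m)
singletons-lah r zero    = isLah refl [] [] [] [] [] , []
singletons-lah r (suc m) = newBlock⁺ (singletons-lah r m)

-- Up to `r`, every element must open its own block: the other outcome of `removeLargest` supplies
-- `r ≤ m`, which fails for the predecessor of a number at most `r`.
singletons-only : ∀ {r ℓ D} m → m ≤ r → IsPartialLah r m ℓ D → ℓ ≡ m × D ≡ singletons m
singletons-only {D = []}          zero _ (lah , _) = sym (IsLah.ℓ-blocks lah) , refl
singletons-only {D = [] ∷ _}      zero _ (lah , _) = contradiction refl (All.head (IsLah.non-empty lah))
singletons-only {D = (_ ∷ _) ∷ _} zero _ (lah , _) with () ← All.head (IsLah.within lah)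
singletons-only (suc m) m<r lah with removeLargest lah
... | inj₁ (D , refl , ℓ′ , refl , lah′) with singletons-only m (<⇒≤ m<r) lah′
...   | refl , refl = refl , refl
singletons-only (suc m) m<r lah | inj₂ (_ , _ , r≤m , _) = contradiction r≤m (<⇒≱ m<r)

blocks-≥ : ∀ {r ℓ D} n → IsPartialLah r (n + r) ℓ D → r ≤ ℓ
blocks-≥ zero lah = ≤-reflexive (sym (proj₁ (singletons-only _ ≤-refl lah)))
blocks-≥ (suc n) lah with removeLargest lah
... | inj₁ (_ , _ , _ , refl , lah′) = m≤n⇒m≤1+n (blocks-≥ n lah′)
... | inj₂ (_ , _ , _ , lah′)        = blocks-≥ n lah′

-- Enumeration of the insertions

insertions : ℕ → Block → List Block
insertions M []      = [ [ M ] ]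
insertions M (x ∷ B) = (M ∷ x ∷ B) ∷ map (x ∷_) (insertions M B)

blockInsertions : ℕ → List Block → List (List Block)
blockInsertions M []      = []
blockInsertions M (B ∷ D) = map (_∷ D) (insertions M B) ++ map (B ∷_) (blockInsertions M D)

length-insertions : ∀ M B → length (insertions M B) ≡ suc (length B)
length-insertions M []      = refl
length-insertions M (x ∷ B) = cong suc (trans (length-map (x ∷_) (insertions M B)) (length-insertions M B))

∈-insertions⁺ : ∀ {M B B′} → Insertion M B B′ → B′ ∈ insertions M B
∈-insertions⁺ {B = []}    here      = here refl
∈-insertions⁺ {B = _ ∷ _} here      = here refl
∈-insertions⁺             (there i) = there (∈-map⁺ _ (∈-insertions⁺ i))

∈-insertions⁻ : ∀ {M} B {B′} → B′ ∈ insertions M B → Insertion M B B′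
∈-insertions⁻ []      (here refl) = here
∈-insertions⁻ (x ∷ B) (here refl) = here
∈-insertions⁻ (x ∷ B) (there B′∈) with _ , C∈ , refl ← ∈-map⁻ (x ∷_) B′∈ = there (∈-insertions⁻ B C∈)

∈-blockInsertions⁺ : ∀ {M D D′} → BlockInsertion M D D′ → D′ ∈ blockInsertions M D
∈-blockInsertions⁺ (here i)          = ∈-++⁺ˡ (∈-map⁺ _ (∈-insertions⁺ i))
∈-blockInsertions⁺ (there {B} {D} j) = ∈-++⁺ʳ (map (_∷ D) (insertions _ B)) (∈-map⁺ _ (∈-blockInsertions⁺ j))

∈-blockInsertions⁻ : ∀ {M} D {D′} → D′ ∈ blockInsertions M D → BlockInsertion M D D′
∈-blockInsertions⁻ {M} (B ∷ D) D′∈ with ∈-++⁻ (map (_∷ D) (insertions M B)) D′∈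
... | inj₁ p with _ , q , refl ← ∈-map⁻ (_∷ D) p = here (∈-insertions⁻ B q)
... | inj₂ p with _ , q , refl ← ∈-map⁻ (B ∷_) p = there (∈-blockInsertions⁻ D q)

_≢?_ : ∀ i j → Dec (i ≢ j)
i ≢? j = ¬? (i ≟ j)

-- A left inverse of both ways of adding `M`, except that an emptied block is kept: undoing a new
-- block leaves a trailing `[]`, which tells the two ways apart.
erase : ℕ → List Block → List Block
erase M = map (filter (_≢? M))

filter-≢ : ∀ {M B} → All (_< M) B → filter (_≢? M) B ≡ B
filter-≢ B<M = filter-all (_≢? _) (All.map <⇒≢ B<M)

erase-bounded : ∀ {M D} → All (BoundedBy M) D → erase M D ≡ D
erase-bounded []               = refl
erase-bounded ((_ , B<M) ∷ bs) = cong₂ _∷_ (filter-≢ B<M) (erase-bounded bs)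

filter-insertion : ∀ {M B B′} → All (_< M) B → Insertion M B B′ → filter (_≢? M) B′ ≡ B
filter-insertion {M} {B} B<M here = trans (filter-reject (_≢? M) {M} {B} (λ M≢M → M≢M refl)) (filter-≢ B<M)
filter-insertion (x<M ∷ B<M) (there i) =
  trans (filter-accept (_≢? _) (<⇒≢ x<M)) (cong (_ ∷_) (filter-insertion B<M i))

erase-blockInsertion : ∀ {M D D′} → All (BoundedBy M) D → BlockInsertion M D D′ → erase M D′ ≡ D
erase-blockInsertion ((_ , B<M) ∷ bs) (here i) = cong₂ _∷_ (filter-insertion B<M i) (erase-bounded bs)
erase-blockInsertion ((_ , B<M) ∷ bs) (there j) = cong₂ _∷_ (filter-≢ B<M) (erase-blockInsertion bs j)

erase-newBlock : ∀ {M D} → All (BoundedBy M) D → erase M (D ++ [ [ M ] ]) ≡ D ++ [ [] ]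
erase-newBlock {M} {D} bs = trans (map-++ _ D [ [ M ] ])
  (cong₂ (λ D B → D ++ [ B ]) (erase-bounded bs) (filter-reject (_≢? M) {M} {[]} (λ M≢M → M≢M refl)))

insertions-unique : ∀ {M B} → All (_< M) B → Unique (insertions M B)
insertions-unique []          = [] ∷ []
insertions-unique (x<M ∷ B<M) =
  All.map⁺ (All.universal (λ _ eq → <⇒≢ x<M (sym (∷-injectiveˡ eq))) _)
  ∷ Unique.map⁺ ∷-injectiveʳ (insertions-unique B<M)

-- The two halves of the list are disjoint: the first block contains `M` in one half and is the old
-- `B`, bounded below `M`, in the other.
blockInsertions-unique : ∀ {M D} → All (BoundedBy M) D → Unique (blockInsertions M D)
blockInsertions-unique [] = []
blockInsertions-unique {M} {B ∷ D} ((_ , B<M) ∷ bs) = Unique.++⁺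
  (Unique.map⁺ ∷-injectiveˡ (insertions-unique B<M))
  (Unique.map⁺ ∷-injectiveʳ (blockInsertions-unique bs))
  λ (p , q) → let
    (_ , B′∈ , eq)  = ∈-map⁻ (_∷ D) p
    (_ , _   , eq′) = ∈-map⁻ (B ∷_) q
    B≡B′ = ∷-injectiveˡ (trans (sym eq′) eq)
    M∈B′ = ∈-resp-↭ (insertion-↭ (∈-insertions⁻ B B′∈)) (here refl)
    in <-irrefl refl (All.lookup B<M (subst (M ∈_) (sym B≡B′) M∈B′))

-- The recurrence for the lists of r-Lah distributions

-- A new block raises the block count, so the sources have index k - 1; for k = 0 there are none.
newBlocks : (r n k : ℕ) → List (List Block)
newBlocks r n zero    = []
newBlocks r n (suc k) = map (_++ [ [ suc (n + r) ] ]) (𝓛 r n k)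

lah : ∀ {r n k D} → D ∈ 𝓛 r n k → IsPartialLah r (n + r) (k + r) D
lah {r} {n} {k} {D} = Equivalence.to (∈-𝓛 r n k D)

lah-bounded : ∀ {r n k D} → D ∈ 𝓛 r n k → All (BoundedBy (suc (n + r))) D
lah-bounded {r} {n} {k} D∈ = let (l , _) = lah {r} {n} {k} D∈ in bounded (IsLah.non-empty l) (lah⇒↭ l)

-- The combinatorial form of the triangle recurrence. Both sides are free of repetitions, so it
-- suffices that they have the same members. On the right, `erase` recovers the source of each
-- insertion.
𝓛-suc : ∀ r n k → 𝓛 r (suc n) k ↭ newBlocks r n k ++ concatMap (blockInsertions (suc (n + r))) (𝓛 r n k)
𝓛-suc r n k = unique-↭ (𝓛-unique r (suc n) k)
  (Unique.++⁺ (new-unique k)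
    (unique-concatMap (blockInsertions M) (erase M) (𝓛-unique r n k)
      (All.tabulate λ {D} D∈ → let bs = lah-bounded {r} {n} {k} D∈ in
        blockInsertions-unique bs ,
        All.tabulate (λ D′∈ → erase-blockInsertion bs (∈-blockInsertions⁻ D D′∈))))
    (λ (p , q) → disjoint k p q))
  (mk⇔ (to k) (from ∘ ∈-++⁻ (newBlocks r n k)))
  where
  M = suc (n + r)

  new-unique : ∀ k → Unique (newBlocks r n k)
  new-unique zero    = []
  new-unique (suc k) = Unique.map⁺ (++-cancelʳ _ _ _) (𝓛-unique r n k)

  -- Erasing the largest element of a common member in both ways would give `E ≡ D ++ [ [] ]`, but
  -- `E` has no empty block.
  disjoint : ∀ k′ {D′} → D′ ∈ newBlocks r n k′ → ¬ D′ ∈ concatMap (blockInsertions M) (𝓛 r n k)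
  disjoint (suc k′) D′∈ D′∈′
    with D , D∈ , refl ← ∈-map⁻ _ D′∈
       | E , E∈ , D′∈E ← find (∈-concatMap⁻ (blockInsertions M) {xs = 𝓛 r n k} D′∈′)
    = contradiction refl (All.head (All.++⁻ʳ D (subst (All (_≢ [])) E≡ (All.map proj₁ E-bounded))))
    where
    E-bounded = lah-bounded {r} {n} {k} E∈
    E≡ : E ≡ D ++ [ [] ]
    E≡ = trans (sym (erase-blockInsertion E-bounded (∈-blockInsertions⁻ E D′∈E)))
               (erase-newBlock (lah-bounded {r} {n} {k′} D∈))

  to : ∀ k {D′} → D′ ∈ 𝓛 r (suc n) k → D′ ∈ newBlocks r n k ++ concatMap (blockInsertions M) (𝓛 r n k)
  to k D′∈ with removeLargest (lah {r} {suc n} {k} D′∈)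
  to k D′∈ | inj₂ (D , j , _ , l) = ∈-++⁺ʳ (newBlocks r n k)
    (∈-concatMap⁺ (blockInsertions M) (lose (Equivalence.from (∈-𝓛 r n k D) l) (∈-blockInsertions⁺ j)))
  -- Removing a singleton block would leave r - 1 blocks, against the lower bound `r`.
  to zero D′∈ | inj₁ (D , refl , ℓ′ , refl , l) = contradiction (blocks-≥ n l) (<⇒≱ ≤-refl)
  to (suc k) D′∈ | inj₁ (D , refl , ℓ′ , refl , l) = ∈-++⁺ˡ (∈-map⁺ _ (Equivalence.from (∈-𝓛 r n k D) l))

  new⊆ : ∀ k {D′} → D′ ∈ newBlocks r n k → D′ ∈ 𝓛 r (suc n) k
  new⊆ (suc k) D′∈ with D , D∈ , refl ← ∈-map⁻ _ D′∈ =
    Equivalence.from (∈-𝓛 r (suc n) (suc k) _) (newBlock⁺ (lah {r} {n} {k} D∈))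

  from : ∀ {D′} → D′ ∈ newBlocks r n k ⊎ D′ ∈ concatMap (blockInsertions M) (𝓛 r n k) → D′ ∈ 𝓛 r (suc n) k
  from (inj₁ D′∈) = new⊆ k D′∈
  from (inj₂ D′∈) with D , D∈ , D′∈D ← find (∈-concatMap⁻ (blockInsertions M) {xs = 𝓛 r n k} D′∈) =
    Equivalence.from (∈-𝓛 r (suc n) k _) (insert⁺ (m≤n+m r n) (lah {r} {n} {k} D∈) (∈-blockInsertions⁻ D D′∈D))

𝓛-zero-zero : ∀ r → 𝓛 r 0 0 ↭ [ singletons r ]
𝓛-zero-zero r = unique-↭ (𝓛-unique r 0 0) ([] ∷ []) (mk⇔
  (λ D∈ → here (proj₂ (singletons-only r ≤-refl (lah {r} {0} {0} D∈))))
  (λ { (here refl) → Equivalence.from (∈-𝓛 r 0 0 _) (singletons-lah r r) }))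

𝓛-zero-suc : ∀ r k → 𝓛 r 0 (suc k) ≡ []
𝓛-zero-suc r k with 𝓛 r 0 (suc k) in eq
... | []    = refl
... | D ∷ _ = contradiction (sym (proj₁ (singletons-only r ≤-refl (lah {r} {0} {suc k} (subst (D ∈_) (sym eq) (here refl))))))
                (<⇒≢ (s≤s (m≤n+m r k)))

-- How the statistics change under insertion

indicator : Bool → ℕ
indicator true  = 1
indicator false = 0

-- Counts the elements i of a block with p l i, where l lists the elements to the left of i.
count : (List ℕ → ℕ → Bool) → Block → ℕ
count p []      = 0
count p (x ∷ B) = indicator (p [] x) + count (p ∘ (x ∷_)) B

length-filter-map : ∀ {A B : Set} {P : B → Set} (P? : Decidable P) (f : A → B) xs →
  length (filter P? (map f xs)) ≡ length (filter (P? ∘ f) xs)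
length-filter-map P? f [] = refl
length-filter-map P? f (x ∷ xs) with does (P? (f x))
... | false = length-filter-map P? f xs
... | true  = cong suc (length-filter-map P? f xs)

positions-∷ : ∀ x B → positions (x ∷ B) ≡ ([] , x) ∷ map (map₁ (x ∷_)) (positions B)
positions-∷ x B = cong (([] , x) ∷_)
  (trans (cong (zip (map (x ∷_) (inits B))) (sym (map-id B))) (zip-map (x ∷_) id (inits B) B))

count-positions : {P : List ℕ × ℕ → Set} (P? : Decidable P) → ∀ B →
  length (filter P? (positions B)) ≡ count (λ l i → does (P? (l , i))) B
count-positions P? []      = refl
count-positions P? (x ∷ B) = trans (cong (length ∘ filter P?) (positions-∷ x B)) step
  where
  rest : length (filter P? (map (map₁ (x ∷_)) (positions B))) ≡ count (λ l i → does (P? (x ∷ l , i))) B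
  rest = trans (length-filter-map P? (map₁ (x ∷_)) (positions B)) (count-positions (P? ∘ map₁ (x ∷_)) B)
  step : length (filter P? (([] , x) ∷ map (map₁ (x ∷_)) (positions B)))
         ≡ indicator (does (P? ([] , x))) + count (λ l i → does (P? (x ∷ l , i))) B
  step with does (P? ([] , x))
  ... | false = rest
  ... | true  = cong suc rest

count-cong : ∀ {M p q B} → All (_< M) B → (∀ l i → i < M → p l i ≡ q l i) → count p B ≡ count q B
count-cong []          e = refl
count-cong (x<M ∷ B<M) e = cong₂ _+_ (cong indicator (e [] _ x<M)) (count-cong B<M (λ l → e (_ ∷ l)))

-- The last three hypotheses concern the positions to the left of `M`, those to its right, and `M`
-- itself. Two tests `p` and `q` occur because being smallest refers to the whole block, which the
-- insertion changes.
count-insertion : ∀ {M p q B B′} c → Insertion M B B′ → All (_< M) B →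
  (∀ l i → i < M → p l i ≡ q l i) →
  (∀ {l l′} i → Insertion M l l′ → i < M → p l′ i ≡ q l i) →
  (∀ l → p l M ≡ c) →
  count p B′ ≡ indicator c + count q B
count-insertion c here B<M e e′ eM =
  cong₂ _+_ (cong indicator (eM [])) (count-cong B<M (λ l i → e′ i here))
count-insertion {p = p} {q} c (there {x} {B} j) (x<M ∷ B<M) e e′ eM = trans
  (cong₂ _+_ (cong indicator (e [] x x<M))
    (count-insertion c j B<M (λ l → e (x ∷ l)) (λ i → e′ i ∘ there) (λ l → eM (x ∷ l))))
  (x∙yz≈y∙xz (indicator (q [] x)) (indicator c) (count (q ∘ (x ∷_)) B))

nrecᴮ rec*ᴮ : Block → ℕ
nrecᴮ B = length (filter (λ p → ¬? (recordLow? p)) (positions B))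
rec*ᴮ B = length (filter (λ p → recordLow? p ×-dec ¬? (smallest? B (proj₂ p))) (positions B))

recordLow-insertion : ∀ {M l l′ i} → Insertion M l l′ → i < M →
                      does (recordLow? (l′ , i)) ≡ does (recordLow? (l , i))
recordLow-insertion {M} {l} {l′} {i} j i<M = does-⇔
  (mk⇔ (λ low → low ∘ Any-resp-↭ (insertion-↭ j) ∘ there) (λ low → low ∘ back ∘ Any-resp-↭ (↭-sym (insertion-↭ j))))
  (recordLow? (l′ , i)) (recordLow? (l , i))
  where
  back : Any (_< i) (M ∷ l) → Any (_< i) l
  back (here M<i) = contradiction M<i (<-asym i<M)
  back (there l<) = l<

smallest-insertion : ∀ {M B B′ i} → Insertion M B B′ → i < M →
                     does (smallest? B′ i) ≡ does (smallest? B i)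
smallest-insertion {B = B} {B′} {i} j i<M = does-⇔
  (mk⇔ (All.tail ∘ All-resp-↭ (↭-sym (insertion-↭ j))) (λ ≤B → All-resp-↭ (insertion-↭ j) (<⇒≤ i<M ∷ ≤B)))
  (smallest? B′ i) (smallest? B i)

¬smallest-largest : ∀ {M x B B′} → x < M → Insertion M (x ∷ B) B′ → ¬ Smallest B′ M
¬smallest-largest x<M j M≤ with _ ∷ M≤x ∷ _ ← All-resp-↭ (↭-sym (insertion-↭ j)) M≤ = <⇒≱ x<M M≤x

-- With nothing to its left `M` is a record low, and being larger than the rest it spoils no other
-- record low.
nrecᴮ-front : ∀ {M B} → All (_< M) B → nrecᴮ (M ∷ B) ≡ nrecᴮ B
nrecᴮ-front {M} {B} B<M = begin
  nrecᴮ (M ∷ B)           ≡⟨ count-positions notLow? (M ∷ B) ⟩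
  count (λ l i → does (notLow? (M ∷ l , i))) B
                          ≡⟨ count-cong B<M (λ l i i<M → cong not (recordLow-insertion {l = l} here i<M)) ⟩
  count (λ l i → does (notLow? (l , i))) B  ≡⟨ count-positions notLow? B ⟨
  nrecᴮ B                 ∎
  where
  open ≡-Reasoning
  notLow? : ∀ p → Dec (¬ RecordLow p)
  notLow? p = ¬? (recordLow? p)

-- The smaller `x` stands to the left of `M`, so exactly `M` is added to the elements that are not
-- record lows.
nrecᴮ-there : ∀ {M x B B′} → All (_< M) (x ∷ B) → Insertion M B B′ →
              nrecᴮ (x ∷ B′) ≡ suc (nrecᴮ (x ∷ B))
nrecᴮ-there {M} {x} {B} {B′} (x<M ∷ B<M) j = begin
  nrecᴮ (x ∷ B′)         ≡⟨ count-positions notLow? (x ∷ B′) ⟩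
  count notLow (x ∷ B′)  ≡⟨ cong (_+_ (indicator (notLow [] x)))
                              (count-insertion true j B<M (λ _ _ _ → refl)
                                (λ i k i<M → cong not (recordLow-insertion (there k) i<M))
                                (λ l → dec-true (notLow? (x ∷ l , M)) (λ low → low (here x<M)))) ⟩
  indicator (notLow [] x) + suc (count (notLow ∘ (x ∷_)) B)
                         ≡⟨ ℕ.+-suc (indicator (notLow [] x)) _ ⟩
  suc (count notLow (x ∷ B)) ≡⟨ cong suc (count-positions notLow? (x ∷ B)) ⟨
  suc (nrecᴮ (x ∷ B))    ∎
  where
  open ≡-Reasoning
  notLow? : ∀ p → Dec (¬ RecordLow p)
  notLow? p = ¬? (recordLow? p)
  notLow : List ℕ → ℕ → Bool
  notLow l i = does (notLow? (l , i))

low? : ∀ B p → Dec (RecordLow p × ¬ Smallest B (proj₂ p))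
low? B p = recordLow? p ×-dec ¬? (smallest? B (proj₂ p))

low : Block → List ℕ → ℕ → Bool
low B l i = does (low? B (l , i))

-- At the front `M` is a record low, and `x < M` keeps it from being the smallest of its block.
rec*ᴮ-front : ∀ {M x B} → All (_< M) (x ∷ B) → rec*ᴮ (M ∷ x ∷ B) ≡ suc (rec*ᴮ (x ∷ B))
rec*ᴮ-front {M} {x} {B} B<M@(x<M ∷ _) = begin
  rec*ᴮ (M ∷ x ∷ B)       ≡⟨ count-positions (low? (M ∷ x ∷ B)) (M ∷ x ∷ B) ⟩
  indicator (low (M ∷ x ∷ B) [] M) + count (low (M ∷ x ∷ B) ∘ (M ∷_)) (x ∷ B)
                          ≡⟨ cong₂ _+_
                               (cong indicator (dec-true (low? (M ∷ x ∷ B) ([] , M)) ((λ ()) , ¬smallest-largest x<M here)))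
                               (count-cong B<M (λ l i i<M → cong₂ _∧_ (recordLow-insertion {l = l} here i<M)
                                 (cong not (smallest-insertion {B = x ∷ B} here i<M)))) ⟩
  suc (count (low (x ∷ B)) (x ∷ B)) ≡⟨ cong suc (count-positions (low? (x ∷ B)) (x ∷ B)) ⟨
  suc (rec*ᴮ (x ∷ B))     ∎
  where open ≡-Reasoning

rec*ᴮ-there : ∀ {M x B B′} → All (_< M) (x ∷ B) → Insertion M B B′ → rec*ᴮ (x ∷ B′) ≡ rec*ᴮ (x ∷ B)
rec*ᴮ-there {M} {x} {B} {B′} (x<M ∷ B<M) j = begin
  rec*ᴮ (x ∷ B′)                  ≡⟨ count-positions (low? (x ∷ B′)) (x ∷ B′) ⟩
  count (low (x ∷ B′)) (x ∷ B′)   ≡⟨ cong₂ _+_ (cong indicator (low≡ [] x x<M))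
                                       (count-insertion false j B<M (λ l → low≡ (x ∷ l))
                                         (λ i k i<M → cong₂ _∧_ (recordLow-insertion (there k) i<M) (smallest≡ i<M))
                                         (λ l → dec-false (low? (x ∷ B′) (x ∷ l , M)) (λ (low , _) → low (here x<M)))) ⟩
  count (low (x ∷ B)) (x ∷ B)     ≡⟨ count-positions (low? (x ∷ B)) (x ∷ B) ⟨
  rec*ᴮ (x ∷ B)                   ∎
  where
  open ≡-Reasoning
  smallest≡ : ∀ {i} → i < M → not (does (smallest? (x ∷ B′) i)) ≡ not (does (smallest? (x ∷ B) i))
  smallest≡ = cong not ∘ smallest-insertion (there j)
  low≡ : ∀ l i → i < M → low (x ∷ B′) l i ≡ low (x ∷ B) l i
  low≡ l i i<M = cong (does (recordLow? (l , i)) ∧_) (smallest≡ i<M)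

nrec-newBlock : ∀ D M → nrec (D ++ [ [ M ] ]) ≡ nrec D
nrec-newBlock D M = trans (cong sum (map-++ nrecᴮ D [ [ M ] ])) (trans (sum-++ (map nrecᴮ D) _) (ℕ.+-identityʳ _))

rec*ᴮ-singleton : ∀ M → rec*ᴮ [ M ] ≡ 0
rec*ᴮ-singleton M = trans (count-positions (low? [ M ]) [ M ])
  (cong (λ c → indicator c + 0) (dec-false (low? [ M ] ([] , M)) (λ (_ , ¬M≤M) → ¬M≤M (≤-refl ∷ []))))

rec*-newBlock : ∀ D M → rec* (D ++ [ [ M ] ]) ≡ rec* D
rec*-newBlock D M = trans (cong sum (map-++ rec*ᴮ D [ [ M ] ]))
  (trans (sum-++ (map rec*ᴮ D) _)
    (trans (cong (λ c → rec* D + (c + 0)) (rec*ᴮ-singleton M)) (ℕ.+-identityʳ _)))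

nrec-singletons : ∀ m → nrec (singletons m) ≡ 0
nrec-singletons zero    = refl
nrec-singletons (suc m) = trans (nrec-newBlock (singletons m) (suc m)) (nrec-singletons m)

rec*-singletons : ∀ m → rec* (singletons m) ≡ 0
rec*-singletons zero    = refl
rec*-singletons (suc m) = trans (rec*-newBlock (singletons m) (suc m)) (rec*-singletons m)

-- Sums and the recurrences

module Sums {c ℓ} (R : CommutativeRing c ℓ) where
  open RLahNumbers R
  open CommutativeRing R hiding (Carrier; _≈_; 0#; 1#; _*_; _+_; zero)
    renaming (refl to ≈-refl; sym to ≈-sym; trans to ≈-trans)
  open import Algebra.Properties.Semiring.Mult semiring using (×-congʳ; ×-congˡ; ×-homo-+; ×-comm-*)
  open import Algebra.Properties.CommutativeMonoid.Mult +-commutativeMonoid using (×-distrib-+)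
  open import Algebra.Properties.CommutativeSemigroup +-commutativeSemigroup using (interchange)
  open import Relation.Binary.Reasoning.Setoid setoid

  ∑-++ : {A : Set} (xs ys : List A) (f : A → Carrier) → ∑ (xs ++ ys) f ≈ ∑ xs f ⊕ ∑ ys f
  ∑-++ []       ys f = ≈-sym (+-identityˡ _)
  ∑-++ (x ∷ xs) ys f = ≈-trans (+-congˡ (∑-++ xs ys f)) (≈-sym (+-assoc _ _ _))

  ∑-map : {A B : Set} (g : A → B) (xs : List A) (f : B → Carrier) → ∑ (map g xs) f ≡ ∑ xs (f ∘ g)
  ∑-map g []       f = refl
  ∑-map g (x ∷ xs) f = cong (f (g x) ⊕_) (∑-map g xs f)

  ∑-congᴬ : {A : Set} {xs : List A} {f g : A → Carrier} → All (λ x → f x ≈ g x) xs → ∑ xs f ≈ ∑ xs g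
  ∑-congᴬ []       = ≈-refl
  ∑-congᴬ (e ∷ es) = +-cong e (∑-congᴬ es)

  ∑-cong : {A : Set} (xs : List A) {f g : A → Carrier} → (∀ x → f x ≈ g x) → ∑ xs f ≈ ∑ xs g
  ∑-cong []       e = ≈-refl
  ∑-cong (x ∷ xs) e = +-cong (e x) (∑-cong xs e)

  ∑-⊕ : {A : Set} (xs : List A) (f g : A → Carrier) → ∑ xs (λ x → f x ⊕ g x) ≈ ∑ xs f ⊕ ∑ xs g
  ∑-⊕ []       f g = ≈-sym (+-identityˡ _)
  ∑-⊕ (x ∷ xs) f g = ≈-trans (+-congˡ (∑-⊕ xs f g)) (interchange _ _ _ _)

  ∑-*ˡ : {A : Set} (xs : List A) (y : Carrier) (f : A → Carrier) → ∑ xs (λ x → y * f x) ≈ y * ∑ xs f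
  ∑-*ˡ []       y f = ≈-sym (zeroʳ y)
  ∑-*ˡ (x ∷ xs) y f = ≈-trans (+-congˡ (∑-*ˡ xs y f)) (≈-sym (distribˡ y _ _))

  ∑-0 : {A : Set} (xs : List A) → ∑ xs (λ _ → 0#) ≈ 0#
  ∑-0 []       = ≈-refl
  ∑-0 (x ∷ xs) = ≈-trans (+-identityˡ _) (∑-0 xs)

  ∑-const : {A : Set} {xs : List A} {f : A → Carrier} {y : Carrier} →
            All (λ x → f x ≈ y) xs → ∑ xs f ≈ length xs · y
  ∑-const []       = ≈-refl
  ∑-const (e ∷ es) = +-cong e (∑-const es)

  ∑-concatMap : {A B : Set} (g : A → List B) (xs : List A) (f : B → Carrier) →
                ∑ (concatMap g xs) f ≈ ∑ xs (λ x → ∑ (g x) f)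
  ∑-concatMap g []       f = ≈-refl
  ∑-concatMap g (x ∷ xs) f = ≈-trans (∑-++ (g x) _ f) (+-congˡ (∑-concatMap g xs f))

  upTo-suc : ∀ n → upTo (suc n) ≡ 0 ∷ map suc (upTo n)
  upTo-suc n = cong (0 ∷_) (sym (map-upTo suc n))

  ∑-first : ∀ n (f : ℕ → Carrier) → ∑ (upTo (suc n)) f ≡ f 0 ⊕ ∑ (upTo n) (f ∘ suc)
  ∑-first n f = trans (cong (λ xs → ∑ xs f) (upTo-suc n)) (cong (f 0 ⊕_) (∑-map suc (upTo n) f))

  ∑-last : ∀ n (f : ℕ → Carrier) → ∑ (upTo (suc n)) f ≈ ∑ (upTo n) f ⊕ f n
  ∑-last n f = begin
    ∑ (upTo (suc n)) f     ≡⟨ cong (λ xs → ∑ xs f) (upTo-∷ʳ n) ⟨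
    ∑ (upTo n ++ [ n ]) f  ≈⟨ ∑-++ (upTo n) [ n ] f ⟩
    ∑ (upTo n) f ⊕ ∑ [ n ] f ≈⟨ +-congˡ (+-identityʳ _) ⟩
    ∑ (upTo n) f ⊕ f n     ∎

  ∑-upTo-cong : ∀ n {f g : ℕ → Carrier} → (∀ i → i < n → f i ≈ g i) → ∑ (upTo n) f ≈ ∑ (upTo n) g
  ∑-upTo-cong zero    e = ≈-refl
  ∑-upTo-cong (suc n) {f} {g} e = begin
    ∑ (upTo (suc n)) f          ≡⟨ ∑-first n f ⟩
    f 0 ⊕ ∑ (upTo n) (f ∘ suc)  ≈⟨ +-cong (e 0 (s≤s z≤n)) (∑-upTo-cong n (λ i i<n → e (suc i) (s≤s i<n))) ⟩
    g 0 ⊕ ∑ (upTo n) (g ∘ suc)  ≡⟨ ∑-first n g ⟨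
    ∑ (upTo (suc n)) g          ∎

  ∏-first : ∀ n (f : ℕ → Carrier) → ∏ (upTo (suc n)) f ≡ f 0 * ∏ (upTo n) (f ∘ suc)
  ∏-first n f = trans (cong (λ xs → ∏ xs f) (upTo-suc n)) (cong (f 0 *_) (∏-map (upTo n)))
    where
    ∏-map : ∀ xs → ∏ (map suc xs) f ≡ ∏ xs (f ∘ suc)
    ∏-map []       = refl
    ∏-map (x ∷ xs) = cong (f (suc x) *_) (∏-map xs)

  ∏-cong : {A : Set} (xs : List A) {f g : A → Carrier} → (∀ x → f x ≈ g x) → ∏ xs f ≈ ∏ xs g
  ∏-cong []       e = ≈-refl
  ∏-cong (x ∷ xs) e = *-cong (e x) (∏-cong xs e)

  -- The coefficients of the product of two exponential generating functions.
  conv : ℕ → (ℕ → Carrier) → (ℕ → Carrier) → Carrier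
  conv n u v = ∑ (upTo (suc n)) (λ i → (n C i) · (u (n ∸ i) * v i))

  conv-cong : ∀ n {u u′ v v′} → (∀ i → u i ≈ u′ i) → (∀ i → v i ≈ v′ i) → conv n u v ≈ conv n u′ v′
  conv-cong n e e′ = ∑-cong (upTo (suc n)) (λ i → ×-congʳ (n C i) (*-cong (e (n ∸ i)) (e′ i)))

  conv-⊕ˡ : ∀ n u u′ v → conv n (λ i → u i ⊕ u′ i) v ≈ conv n u v ⊕ conv n u′ v
  conv-⊕ˡ n u u′ v = ≈-trans
    (∑-cong (upTo (suc n)) (λ i → ≈-trans (×-congʳ (n C i) (distribʳ _ _ _)) (×-distrib-+ _ _ (n C i))))
    (∑-⊕ (upTo (suc n)) _ _)

  conv-*ˡ : ∀ n x u v → conv n (λ i → x * u i) v ≈ x * conv n u v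
  conv-*ˡ n x u v = ≈-trans
    (∑-cong (upTo (suc n)) (λ i → ≈-trans (×-congʳ (n C i) (*-assoc _ _ _)) (≈-sym (×-comm-* (n C i) _ _))))
    (∑-*ˡ (upTo (suc n)) x _)

  conv-*ʳ : ∀ n x u v → conv n u (λ i → x * v i) ≈ x * conv n u v
  conv-*ʳ n x u v = ≈-trans
    (∑-cong (upTo (suc n)) (λ i → ×-congʳ (n C i) (≈-trans (≈-sym (*-assoc _ _ _)) (*-congʳ (*-comm _ _)))))
    (conv-*ˡ n x u v)

  -- The Leibniz rule for the derivative of a product of exponential generating functions, obtained
  -- from Pascal's rule.
  conv-suc : ∀ n u v → conv (suc n) u v ≈ conv n (u ∘ suc) v ⊕ conv n u (v ∘ suc)
  conv-suc n u v = begin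
    ∑ (upTo (2 + n)) t
      ≡⟨ ∑-first (suc n) t ⟩
    t 0 ⊕ ∑ (upTo (suc n)) (t ∘ suc)
      ≈⟨ +-congˡ (∑-cong (upTo (suc n)) pascal) ⟩
    t 0 ⊕ ∑ (upTo (suc n)) (λ i → s′ i ⊕ s (suc i))
      ≈⟨ +-congˡ (≈-trans (∑-⊕ (upTo (suc n)) s′ (s ∘ suc)) (+-comm _ _)) ⟩
    t 0 ⊕ (∑ (upTo (suc n)) (s ∘ suc) ⊕ conv n u (v ∘ suc))
      ≈⟨ +-assoc _ _ _ ⟨
    (s 0 ⊕ ∑ (upTo (suc n)) (s ∘ suc)) ⊕ conv n u (v ∘ suc)
      ≡⟨ cong (_⊕ conv n u (v ∘ suc)) (∑-first (suc n) s) ⟨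
    ∑ (upTo (2 + n)) s ⊕ conv n u (v ∘ suc)
      ≈⟨ +-congʳ (∑-last (suc n) s) ⟩
    (∑ (upTo (suc n)) s ⊕ s (suc n)) ⊕ conv n u (v ∘ suc)
      -- The extra term at i = n + 1 vanishes with its binomial coefficient.
      ≈⟨ +-congʳ (+-congˡ (×-congˡ (k>n⇒nCk≡0 (n<1+n n)))) ⟩
    (∑ (upTo (suc n)) s ⊕ 0#) ⊕ conv n u (v ∘ suc)
      ≈⟨ +-congʳ (≈-trans (+-identityʳ _) (∑-upTo-cong (suc n) s≈)) ⟩
    conv n (u ∘ suc) v ⊕ conv n u (v ∘ suc)
      ∎
    where
    t s s′ : ℕ → Carrier
    t i  = (suc n C i) · (u (suc n ∸ i) * v i)
    s i  = (n C i) · (u (suc n ∸ i) * v i)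
    s′ i = (n C i) · (u (n ∸ i) * v (suc i))

    pascal : ∀ i → t (suc i) ≈ s′ i ⊕ s (suc i)
    pascal i = ≈-trans (×-congˡ (sym (nCk+nC[k+1]≡[n+1]C[k+1] n i)))
                     (×-homo-+ _ (n C i) (n C suc i))

    -- As `∸` truncates, `suc n ∸ i ≡ suc (n ∸ i)` relies on `i ≤ n`.
    s≈ : ∀ i → i < suc n → s i ≈ (n C i) · (u (suc (n ∸ i)) * v i)
    s≈ i i≤n = ×-congʳ (n C i) (*-congʳ (reflexive (cong u (ℕ.+-∸-assoc 1 (s≤s⁻¹ i≤n)))))

-- Solving the triangle recurrence, and the convolution formula for row sums

module Triangle {c ℓ} (R : CommutativeRing c ℓ) (a b : CommutativeRing.Carrier R) where
  open RLahNumbers R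
  open CommutativeRing R hiding (Carrier; _≈_; 0#; 1#; _*_; _+_; zero)
    renaming (refl to ≈-refl; sym to ≈-sym; trans to ≈-trans)
  open Sums R
  open import Algebra.Solver.Ring.NaturalCoefficients.Default commutativeSemiring
    using (solve; _:+_; _:*_; _:=_; con)
  open import Relation.Binary.Reasoning.Setoid setoid

  delayed : (ℕ → Carrier) → ℕ → Carrier
  delayed f zero    = 0#
  delayed f (suc k) = f k

  -- The n-th derivative at 0 of (1 − ax)^(−z/a) u^k / k!, where u = ((1 − ax)^(−b/a) − 1) / b,
  -- defined by differentiating once.
  h : ℕ → ℕ → Carrier → Carrier
  h zero    zero    z = 1#
  h zero    (suc k) z = 0#
  h (suc n) k       z = z * h n k (z ⊕ a) ⊕ delayed (λ k → h n k (z ⊕ (a ⊕ b))) k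

  h-cong : ∀ n k {y z} → y ≈ z → h n k y ≈ h n k z
  h-cong zero    zero    e = ≈-refl
  h-cong zero    (suc k) e = ≈-refl
  h-cong (suc n) zero    e = +-congʳ (*-cong e (h-cong n zero (+-congʳ e)))
  h-cong (suc n) (suc k) e = +-cong (*-cong e (h-cong n (suc k) (+-congʳ e))) (h-cong n k (+-congʳ e))

  -- Induction on `n`, with the triangle applied at the shifted arguments. Raising z by a absorbs
  -- one step of n, and raising it by a + b absorbs one step of n and one of k, so both terms
  -- acquire the same factor (n+1)a + kb + z. The remaining terms reassemble by the definition of
  -- `h`.
  h-triangle : ∀ n k z →
    h (suc n) k z ≈ delayed (λ k → h n k z) k ⊕ ((n · a ⊕ k · b) ⊕ z) * h n k z
  h-triangle zero zero z =
    solve 1 (λ z → z :* con 1 :+ con 0 := con 0 :+ ((con 0 :+ con 0) :+ z) :* con 1) ≈-refl z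
  h-triangle zero (suc zero) z =
    solve 2 (λ z x → z :* con 0 :+ con 1 := con 1 :+ ((con 0 :+ x) :+ z) :* con 0) ≈-refl z (1 · b)
  h-triangle zero (suc (suc k)) z =
    solve 2 (λ z x → z :* con 0 :+ con 0 := con 0 :+ ((con 0 :+ x) :+ z) :* con 0) ≈-refl z (suc (suc k) · b)
  h-triangle (suc n) zero z = begin
    z * h (suc n) 0 (z ⊕ a) ⊕ 0#
      ≈⟨ +-congʳ (*-congˡ (h-triangle n 0 (z ⊕ a))) ⟩
    z * (0# ⊕ ((n · a ⊕ 0#) ⊕ (z ⊕ a)) * h n 0 (z ⊕ a)) ⊕ 0#
      ≈⟨ solve 4 (λ a z m x →
           z :* (con 0 :+ ((m :+ con 0) :+ (z :+ a)) :* x) :+ con 0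
           := con 0 :+ (((a :+ m) :+ con 0) :+ z) :* (z :* x :+ con 0))
           ≈-refl a z (n · a) (h n 0 (z ⊕ a)) ⟩
    0# ⊕ ((suc n · a ⊕ 0#) ⊕ z) * (z * h n 0 (z ⊕ a) ⊕ 0#)
      ∎
  h-triangle (suc n) (suc k) z = begin
    z * h (suc n) (suc k) (z ⊕ a) ⊕ h (suc n) k (z ⊕ (a ⊕ b))
      ≈⟨ +-cong (*-congˡ (h-triangle n (suc k) (z ⊕ a))) (h-triangle n k (z ⊕ (a ⊕ b))) ⟩
    z * (h n k (z ⊕ a) ⊕ ((n · a ⊕ suc k · b) ⊕ (z ⊕ a)) * h n (suc k) (z ⊕ a))
      ⊕ (d ⊕ ((n · a ⊕ k · b) ⊕ (z ⊕ (a ⊕ b))) * h n k (z ⊕ (a ⊕ b)))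
      ≈⟨ solve 9 (λ a b z m l x y w d →
           z :* (x :+ ((m :+ (b :+ l)) :+ (z :+ a)) :* y) :+ (d :+ ((m :+ l) :+ (z :+ (a :+ b))) :* w)
           := (z :* x :+ d) :+ (((a :+ m) :+ (b :+ l)) :+ z) :* (z :* y :+ w))
           ≈-refl a b z (n · a) (k · b) (h n k (z ⊕ a)) (h n (suc k) (z ⊕ a)) (h n k (z ⊕ (a ⊕ b))) d ⟩
    h (suc n) k z ⊕ ((suc n · a ⊕ suc k · b) ⊕ z) * h (suc n) (suc k) z
      ∎
    where d = delayed (λ k → h n k (z ⊕ (a ⊕ b))) k

  -- Formally, the n-th derivative at 0 of (1 - ax)^(-z/a) exp(u), with `u` as for `h`.
  ρ : ℕ → Carrier → Carrier
  ρ zero    z = 1#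
  ρ (suc n) z = z * ρ n (z ⊕ a) ⊕ ρ n (z ⊕ (a ⊕ b))

  ρ-cong : ∀ n {y z} → y ≈ z → ρ n y ≈ ρ n z
  ρ-cong zero    e = ≈-refl
  ρ-cong (suc n) e = +-cong (*-cong e (ρ-cong n (+-congʳ e))) (ρ-cong n (+-congʳ e))

  -- A general bound `N` suits the induction: the index shift shortens the range of the second term
  -- by one and leaves that of the first alone.
  ∑-h : ∀ n N z → n < N → ∑ (upTo N) (λ k → h n k z) ≈ ρ n z
  ∑-h zero (suc N) z _ = begin
    ∑ (upTo (suc N)) (λ k → h 0 k z)  ≡⟨ ∑-first N (λ k → h 0 k z) ⟩
    1# ⊕ ∑ (upTo N) (λ _ → 0#)        ≈⟨ +-congˡ (∑-0 (upTo N)) ⟩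
    1# ⊕ 0#                           ≈⟨ +-identityʳ 1# ⟩
    1#                                ∎
  ∑-h (suc n) (suc N) z (s≤s n<N) = begin
    ∑ (upTo (suc N)) (λ k → z * h n k (z ⊕ a) ⊕ d k)
      ≈⟨ ∑-⊕ (upTo (suc N)) _ d ⟩
    ∑ (upTo (suc N)) (λ k → z * h n k (z ⊕ a)) ⊕ ∑ (upTo (suc N)) d
      ≈⟨ +-cong (∑-*ˡ (upTo (suc N)) z _) (≈-trans (reflexive (∑-first N d)) (+-identityˡ _)) ⟩
    z * ∑ (upTo (suc N)) (λ k → h n k (z ⊕ a)) ⊕ ∑ (upTo N) (λ k → h n k (z ⊕ (a ⊕ b)))
      ≈⟨ +-cong (*-congˡ (∑-h n (suc N) (z ⊕ a) (m≤n⇒m≤1+n n<N))) (∑-h n N (z ⊕ (a ⊕ b)) n<N) ⟩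
    z * ρ n (z ⊕ a) ⊕ ρ n (z ⊕ (a ⊕ b))
      ∎
    where d = delayed (λ k → h n k (z ⊕ (a ⊕ b)))

  -- Formally, the derivatives at 0 of (1 - ax)^(-z/a).
  rising : Carrier → ℕ → Carrier
  rising z i = ∏ (upTo i) (λ j → j · a ⊕ z)

  rising-suc : ∀ z i → rising z (suc i) ≈ z * rising (z ⊕ a) i
  rising-suc z i = ≈-trans (reflexive (∏-first i (λ j → j · a ⊕ z)))
    (*-cong (+-identityˡ z) (∏-cong (upTo i) λ j →
      solve 3 (λ a m z → (a :+ m) :+ z := m :+ (z :+ a)) ≈-refl a (j · a) z))

  -- For generating functions this is (1 - ax)^(-(y+z)/a) = (1 - ax)^(-y/a) (1 - ax)^(-z/a). The
  -- proof is an induction that matches the recursion of `ρ` with the Leibniz rule.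
  ρ-⊕ : ∀ n y z → ρ n (y ⊕ z) ≈ conv n (λ i → ρ i y) (rising z)
  ρ-⊕ zero y z =
    solve 0 (con 1 := (con 1 :* con 1 :+ con 0) :+ con 0) ≈-refl
  ρ-⊕ (suc n) y z = begin
    (y ⊕ z) * ρ n ((y ⊕ z) ⊕ a) ⊕ ρ n ((y ⊕ z) ⊕ (a ⊕ b))
      -- The part with y and the last term will rebuild `ρ (suc i) y`; the part with z will rebuild
      -- `rising z (suc i)`.
      ≈⟨ solve 4 (λ y z x w → (y :+ z) :* x :+ w := (y :* x :+ w) :+ z :* x) ≈-refl y z _ _ ⟩
    (y * ρ n ((y ⊕ z) ⊕ a) ⊕ ρ n ((y ⊕ z) ⊕ (a ⊕ b))) ⊕ z * ρ n ((y ⊕ z) ⊕ a)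
      ≈⟨ +-cong (+-cong (*-congˡ (ρ-cong n (swapʳ a))) (ρ-cong n (swapʳ (a ⊕ b)))) (*-congˡ (ρ-cong n (+-assoc y z a))) ⟩
    (y * ρ n ((y ⊕ a) ⊕ z) ⊕ ρ n ((y ⊕ (a ⊕ b)) ⊕ z)) ⊕ z * ρ n (y ⊕ (z ⊕ a))
      ≈⟨ +-cong (+-cong (*-congˡ (ρ-⊕ n (y ⊕ a) z)) (ρ-⊕ n (y ⊕ (a ⊕ b)) z)) (*-congˡ (ρ-⊕ n y (z ⊕ a))) ⟩
    (y * conv n (λ i → ρ i (y ⊕ a)) (rising z) ⊕ conv n (λ i → ρ i (y ⊕ (a ⊕ b))) (rising z))
      ⊕ z * conv n (λ i → ρ i y) (rising (z ⊕ a))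
      ≈⟨ +-cong (+-congʳ (conv-*ˡ n y (λ i → ρ i (y ⊕ a)) (rising z))) (conv-*ʳ n z (λ i → ρ i y) (rising (z ⊕ a))) ⟨
    (conv n (λ i → y * ρ i (y ⊕ a)) (rising z) ⊕ conv n (λ i → ρ i (y ⊕ (a ⊕ b))) (rising z))
      ⊕ conv n (λ i → ρ i y) (λ i → z * rising (z ⊕ a) i)
      ≈⟨ +-cong (≈-sym (conv-⊕ˡ n (λ i → y * ρ i (y ⊕ a)) (λ i → ρ i (y ⊕ (a ⊕ b))) (rising z)))
               (conv-cong n {λ i → ρ i y} (λ _ → ≈-refl) (λ i → ≈-sym (rising-suc z i))) ⟩
    conv n (λ i → ρ (suc i) y) (rising z) ⊕ conv n (λ i → ρ i y) (λ i → rising z (suc i))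
      ≈⟨ conv-suc n (λ i → ρ i y) (rising z) ⟨
    conv (suc n) (λ i → ρ i y) (rising z)
      ∎
    where
    swapʳ : ∀ x → (y ⊕ z) ⊕ x ≈ (y ⊕ x) ⊕ z
    swapʳ x = solve 3 (λ y z x → (y :+ z) :+ x := (y :+ x) :+ z) ≈-refl y z x

-- Weights of distributions, and the polynomials as values of `h`

module Weights {c ℓ} (R : CommutativeRing c ℓ) (a b : CommutativeRing.Carrier R) where
  open RLahNumbers R
  open CommutativeRing R hiding (Carrier; _≈_; 0#; 1#; _*_; _+_; zero)
    renaming (refl to ≈-refl; sym to ≈-sym; trans to ≈-trans)
  open Sums R
  open Triangle R a b
  open import Algebra.Properties.Semiring.Mult semiring using (×-congˡ; ×-homo-+; ×-assoc-*)
  open import Algebra.Properties.CommutativeMonoid.Mult +-commutativeMonoid using (×-distrib-+)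
  open import Algebra.Properties.CommutativeSemigroup +-commutativeSemigroup using (interchange)
  open import Algebra.Properties.Semiring.Exp semiring using (^-homo-*)
  open import Algebra.Solver.Ring.NaturalCoefficients.Default commutativeSemiring
    using (solve; _:+_; _:*_; _:=_; con)
  open import Relation.Binary.Reasoning.Setoid setoid

  ∑-↭ : {A : Set} {xs ys : List A} (f : A → Carrier) → xs ↭ ys → ∑ xs f ≈ ∑ ys f
  ∑-↭ f _↭_.refl         = ≈-refl
  ∑-↭ f (_↭_.prep x p)   = +-congˡ (∑-↭ f p)
  ∑-↭ f (_↭_.swap x y p) = ≈-trans (+-congˡ (+-congˡ (∑-↭ f p)))
    (solve 3 (λ x y s → x :+ (y :+ s) := y :+ (x :+ s)) ≈-refl (f x) (f y) _)
  ∑-↭ f (_↭_.trans p q)  = ≈-trans (∑-↭ f p) (∑-↭ f q)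

  monomial : ℕ → ℕ → Carrier
  monomial i j = a ^ i * b ^ j

  weightᴮ : Block → Carrier
  weightᴮ B = monomial (nrecᴮ B) (rec*ᴮ B)

  weight : List Block → Carrier
  weight D = monomial (nrec D) (rec* D)

  weight-∷ : ∀ B D → weight (B ∷ D) ≈ weightᴮ B * weight D
  weight-∷ B D = ≈-trans
    (*-cong (^-homo-* a (nrecᴮ B) (nrec D)) (^-homo-* b (rec*ᴮ B) (rec* D)))
    (solve 4 (λ x y z w → (x :* y) :* (z :* w) := (x :* z) :* (y :* w)) ≈-refl _ _ _ _)

  weight-newBlock : ∀ D M → weight (D ++ [ [ M ] ]) ≡ weight D
  weight-newBlock D M = cong₂ monomial (nrec-newBlock D M) (rec*-newBlock D M)

  weight-singletons : ∀ m → weight (singletons m) ≈ 1#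
  weight-singletons m = ≈-trans
    (reflexive (cong₂ monomial (nrec-singletons m) (rec*-singletons m)))
    (*-identityˡ 1#)

  -- The front position contributes the factor b, and each of the `length B` positions after an
  -- element contributes a.
  ∑-insertions : ∀ {M B} → BoundedBy M B →
                 ∑ (insertions M B) weightᴮ ≈ (length B · a ⊕ b) * weightᴮ B
  ∑-insertions {M} {[]} (B≢[] , _) = contradiction refl B≢[]
  ∑-insertions {M} {x ∷ B} (_ , B<M) = begin
    weightᴮ (M ∷ x ∷ B) ⊕ ∑ (map (x ∷_) (insertions M B)) weightᴮ
      ≈⟨ +-cong (≈-trans (reflexive (cong₂ monomial (nrecᴮ-front B<M) (rec*ᴮ-front B<M)))
                       (solve 3 (λ b u v → u :* (b :* v) := b :* (u :* v)) ≈-refl b _ _))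
                (∑-const (All.map⁺ (All.tabulate (λ C∈ → after (∈-insertions⁻ B C∈))))) ⟩
    b * weightᴮ (x ∷ B) ⊕ length (map (x ∷_) (insertions M B)) · (a * weightᴮ (x ∷ B))
      ≈⟨ +-congˡ (×-congˡ (trans (length-map (x ∷_) (insertions M B)) (length-insertions M B))) ⟩
    b * weightᴮ (x ∷ B) ⊕ suc (length B) · (a * weightᴮ (x ∷ B))
      ≈⟨ +-congˡ (×-assoc-* (suc (length B)) a _) ⟨
    b * weightᴮ (x ∷ B) ⊕ (suc (length B) · a) * weightᴮ (x ∷ B)
      ≈⟨ ≈-trans (+-comm _ _) (≈-sym (distribʳ _ _ _)) ⟩
    (suc (length B) · a ⊕ b) * weightᴮ (x ∷ B)
      ∎
    where
    after : ∀ {E} → Insertion M B E → weightᴮ (x ∷ E) ≈ a * weightᴮ (x ∷ B)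
    after i = ≈-trans
      (reflexive (cong₂ monomial (nrecᴮ-there B<M i) (rec*ᴮ-there B<M i)))
      (*-assoc _ _ _)

  ∑-blockInsertions : ∀ {M D} → All (BoundedBy M) D →
    ∑ (blockInsertions M D) weight ≈ (length (concat D) · a ⊕ length D · b) * weight D
  ∑-blockInsertions [] = solve 1 (λ x → con 0 := (con 0 :+ con 0) :* x) ≈-refl _
  ∑-blockInsertions {M} {B ∷ D} (bB ∷ bD) = begin
    ∑ (map (_∷ D) (insertions M B) ++ map (B ∷_) (blockInsertions M D)) weight
      ≈⟨ ∑-++ (map (_∷ D) (insertions M B)) _ weight ⟩
    ∑ (map (_∷ D) (insertions M B)) weight ⊕ ∑ (map (B ∷_) (blockInsertions M D)) weight
      ≡⟨ cong₂ _⊕_ (∑-map (_∷ D) (insertions M B) weight) (∑-map (B ∷_) (blockInsertions M D) weight) ⟩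
    ∑ (insertions M B) (λ B′ → weight (B′ ∷ D)) ⊕ ∑ (blockInsertions M D) (λ D′ → weight (B ∷ D′))
      ≈⟨ +-cong (≈-trans (∑-cong (insertions M B) (λ B′ → ≈-trans (weight-∷ B′ D) (*-comm _ _)))
                       (∑-*ˡ (insertions M B) (weight D) weightᴮ))
                (≈-trans (∑-cong (blockInsertions M D) (weight-∷ B)) (∑-*ˡ (blockInsertions M D) (weightᴮ B) weight)) ⟩
    weight D * ∑ (insertions M B) weightᴮ ⊕ weightᴮ B * ∑ (blockInsertions M D) weight
      ≈⟨ +-cong (*-congˡ (∑-insertions bB)) (*-congˡ (∑-blockInsertions bD)) ⟩
    weight D * ((length B · a ⊕ b) * weightᴮ B)
      ⊕ weightᴮ B * ((length (concat D) · a ⊕ length D · b) * weight D)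
      ≈⟨ solve 6 (λ x y p q b r → y :* ((p :+ b) :* x) :+ x :* ((q :+ r) :* y)
                                := ((p :+ q) :+ (b :+ r)) :* (x :* y)) ≈-refl
           (weightᴮ B) (weight D) (length B · a) (length (concat D) · a) b (length D · b) ⟩
    ((length B · a ⊕ length (concat D) · a) ⊕ suc (length D) · b) * (weightᴮ B * weight D)
      ≈⟨ *-cong (+-congʳ (≈-trans (×-congˡ (length-++ B)) (×-homo-+ a (length B) _))) (weight-∷ B D) ⟨
    (length (concat (B ∷ D)) · a ⊕ suc (length D) · b) * weight (B ∷ D)
      ∎

  module _ (r : ℕ) where

    private
      z : Carrier
      z = r · (a ⊕ b)

    -- There are n + r elements to insert after and k + r blocks to insert in front of; the two
    -- shares of r combine to z.
    ∑-insert : ∀ n k → ∑ (concatMap (blockInsertions (suc (n + r))) (𝓛 r n k)) weight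
                       ≈ ((n · a ⊕ k · b) ⊕ z) * 𝒢 a b n k (+ r)
    ∑-insert n k = ≈-trans (∑-concatMap (blockInsertions (suc (n + r))) (𝓛 r n k) weight)
      (≈-trans (∑-congᴬ (All.tabulate each)) (∑-*ˡ (𝓛 r n k) _ weight))
      where
      each : ∀ {D} → D ∈ 𝓛 r n k → ∑ (blockInsertions (suc (n + r)) D) weight ≈ ((n · a ⊕ k · b) ⊕ z) * weight D
      each {D} D∈ = ≈-trans (∑-blockInsertions (lah-bounded {r} {n} {k} D∈)) (*-congʳ (begin
        length (concat D) · a ⊕ length D · b
          ≈⟨ +-cong (×-congˡ |D|≡n+r) (×-congˡ (IsLah.ℓ-blocks D-lah)) ⟩
        (n + r) · a ⊕ (k + r) · b
          ≈⟨ +-cong (×-homo-+ a n r) (×-homo-+ b k r) ⟩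
        (n · a ⊕ r · a) ⊕ (k · b ⊕ r · b)
          ≈⟨ interchange _ _ _ _ ⟩
        (n · a ⊕ k · b) ⊕ (r · a ⊕ r · b)
          ≈⟨ +-congˡ (×-distrib-+ a b r) ⟨
        (n · a ⊕ k · b) ⊕ z
          ∎))
        where
        D-lah : IsLah (n + r) (k + r) D
        D-lah = proj₁ (lah {r} {n} {k} D∈)
        |D|≡n+r : length (concat D) ≡ n + r
        |D|≡n+r = trans (↭-length (lah⇒↭ D-lah))
          (trans (length-map suc (upTo (n + r))) (length-upTo (n + r)))

    ∑-newBlocks : ∀ n k → ∑ (newBlocks r n k) weight ≈ delayed (λ k → 𝒢 a b n k (+ r)) k
    ∑-newBlocks n zero    = ≈-refl
    ∑-newBlocks n (suc k) = ≈-trans (reflexive (∑-map _ (𝓛 r n k) weight))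
      (∑-cong (𝓛 r n k) (λ D → reflexive (weight-newBlock D (suc (n + r)))))

    𝒢-suc : ∀ n k → 𝒢 a b (suc n) k (+ r)
            ≈ delayed (λ k → 𝒢 a b n k (+ r)) k ⊕ ((n · a ⊕ k · b) ⊕ z) * 𝒢 a b n k (+ r)
    𝒢-suc n k = ≈-trans (∑-↭ weight (𝓛-suc r n k))
      (≈-trans (∑-++ (newBlocks r n k) _ weight) (+-cong (∑-newBlocks n k) (∑-insert n k)))

    -- Both sides satisfy the same triangle and agree for n = 0, where the singletons, of weight 1,
    -- are the only distribution.
    𝒢≈h : ∀ n k → 𝒢 a b n k (+ r) ≈ h n k z
    𝒢≈h zero zero    = ≈-trans (∑-↭ weight (𝓛-zero-zero r)) (≈-trans (+-identityʳ _) (weight-singletons r))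
    𝒢≈h zero (suc k) = reflexive (cong (λ Ds → ∑ Ds weight) (𝓛-zero-suc r k))
    𝒢≈h (suc n) k    = ≈-trans (𝒢-suc n k)
      (≈-trans (+-cong (delayed-cong k) (*-congˡ (𝒢≈h n k))) (≈-sym (h-triangle n k z)))
      where
      delayed-cong : ∀ k → delayed (λ k → 𝒢 a b n k (+ r)) k ≈ delayed (λ k → h n k z) k
      delayed-cong zero    = ≈-refl
      delayed-cong (suc k) = 𝒢≈h n k

    𝒢Σ≈ρ : ∀ n → 𝒢Σ a b n (+ r) ≈ ρ n z
    𝒢Σ≈ρ n = ≈-trans (∑-cong (upTo (suc n)) (𝒢≈h n)) (∑-h n (suc n) z ≤-refl)

-- The two identities from the convolution formula

theorem2p6 : ∀ {c ℓ} (R : CommutativeRing c ℓ) → let open RLahNumbers R in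
    (a b : Carrier) (r n : ℕ) →
    ( 𝒢Σ a b n (+ r)
    ≈ ∑ (upTo (suc n)) (λ i →
    (n C i) · (𝒢Σ a b (n ∸ i) 0ℤ * ∏ (upTo i) (λ j → (j · a) ⊕ (r · (a ⊕ b))))) )
    ×
    ( 𝒢Σ a b (suc n) (+ r)
    ≈ (r · ∑ (upTo (suc n)) (λ i →
    (n C i) · (𝒢Σ a b (n ∸ i) (+ r - 1ℤ) * ∏ (upTo (suc i)) (λ j → ((j · a) ⊕ a) ⊕ b))))
    ⊕ ∑ (upTo (suc n)) (λ i →
    (n C i) · (𝒢Σ a b (n ∸ i) (+ r) * ∏ (upTo i) (λ j → ((j · a) ⊕ a) ⊕ b))) )
theorem2p6 R a b r n = first , second r
  where
  open RLahNumbers R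
  open CommutativeRing R hiding (Carrier; _≈_; 0#; 1#; _*_; _+_; zero; _-_)
    renaming (refl to ≈-refl; sym to ≈-sym; trans to ≈-trans)
  open Sums R
  open Triangle R a b
  open Weights R a b
  open import Algebra.Properties.Semiring.Mult semiring using (×-congʳ; ×-assoc-*)
  open import Algebra.Solver.Ring.NaturalCoefficients.Default commutativeSemiring
    using (solve; _:+_; _:=_)
  open import Relation.Binary.Reasoning.Setoid setoid

  first : 𝒢Σ a b n (+ r) ≈ conv n (λ i → 𝒢Σ a b i 0ℤ) (rising (r · (a ⊕ b)))
  first = begin
    𝒢Σ a b n (+ r)              ≈⟨ 𝒢Σ≈ρ r n ⟩
    -- The argument is split with y = 0 because the row sums for r = 0 are the values of `ρ` at
    -- `0 · (a ⊕ b)`, which is `0#`.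
    ρ n (r · (a ⊕ b))           ≈⟨ ρ-cong n (≈-sym (+-identityˡ _)) ⟩
    ρ n (0# ⊕ r · (a ⊕ b))      ≈⟨ ρ-⊕ n 0# (r · (a ⊕ b)) ⟩
    conv n (λ i → ρ i 0#) (rising (r · (a ⊕ b)))
                                ≈⟨ conv-cong n (λ i → ≈-sym (𝒢Σ≈ρ 0 i)) (λ _ → ≈-refl) ⟩
    conv n (λ i → 𝒢Σ a b i 0ℤ) (rising (r · (a ⊕ b))) ∎

  shifted : ℕ → Carrier
  shifted i = ∏ (upTo i) (λ j → ((j · a) ⊕ a) ⊕ b)

  shifted≈ : ∀ i → shifted i ≈ rising (a ⊕ b) i
  shifted≈ i = ∏-cong (upTo i) (λ j → +-assoc (j · a) a b)

  new : ∀ r → ρ n (r · (a ⊕ b) ⊕ (a ⊕ b)) ≈ conv n (λ i → 𝒢Σ a b i (+ r)) shifted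
  new r = ≈-trans (ρ-⊕ n (r · (a ⊕ b)) (a ⊕ b))
    (conv-cong n (λ i → ≈-sym (𝒢Σ≈ρ r i)) (λ i → ≈-sym (shifted≈ i)))

  old : ∀ r → (r · (a ⊕ b)) * ρ n (r · (a ⊕ b) ⊕ a)
            ≈ r · conv n (λ i → 𝒢Σ a b i (+ r - 1ℤ)) (shifted ∘ suc)
  -- Both sides carry the factor `r`, which is 0 here.
  old zero    = zeroˡ _
  old (suc r) = ≈-trans (×-assoc-* (suc r) (a ⊕ b) _) (×-congʳ (suc r) (begin
    (a ⊕ b) * ρ n (((a ⊕ b) ⊕ r · (a ⊕ b)) ⊕ a)
      -- One copy of `a ⊕ b` moves next to `a`, so that `r · (a ⊕ b)` yields the row sums one step
      -- below `suc r`. The outer factor `a ⊕ b` then serves as the factor for j = 0 of the longer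
      -- product.
      ≈⟨ *-congˡ (ρ-cong n (solve 3 (λ c y a → (c :+ y) :+ a := y :+ (c :+ a)) ≈-refl (a ⊕ b) (r · (a ⊕ b)) a)) ⟩
    (a ⊕ b) * ρ n (r · (a ⊕ b) ⊕ ((a ⊕ b) ⊕ a))
      ≈⟨ *-congˡ (ρ-⊕ n (r · (a ⊕ b)) ((a ⊕ b) ⊕ a)) ⟩
    (a ⊕ b) * conv n (λ i → ρ i (r · (a ⊕ b))) (rising ((a ⊕ b) ⊕ a))
      ≈⟨ conv-*ʳ n (a ⊕ b) (λ i → ρ i (r · (a ⊕ b))) (rising ((a ⊕ b) ⊕ a)) ⟨
    conv n (λ i → ρ i (r · (a ⊕ b))) (λ i → (a ⊕ b) * rising ((a ⊕ b) ⊕ a) i)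
      ≈⟨ conv-cong n (λ i → ≈-sym (𝒢Σ≈ρ r i))
           (λ i → ≈-trans (≈-sym (rising-suc (a ⊕ b) i)) (≈-sym (shifted≈ (suc i)))) ⟩
    conv n (λ i → 𝒢Σ a b i (+ r)) (shifted ∘ suc)
      ∎))

  second : ∀ r → 𝒢Σ a b (suc n) (+ r)
    ≈ (r · conv n (λ i → 𝒢Σ a b i (+ r - 1ℤ)) (shifted ∘ suc))
      ⊕ conv n (λ i → 𝒢Σ a b i (+ r)) shifted
  second r = ≈-trans (𝒢Σ≈ρ r (suc n)) (+-cong (old r) (new r))
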